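{- Let $H$ be a graph with chromatic number $r+1\ge 3$. Then there is a least positive integer $g$ such that $H$ is not homomorphic to $K_{r-2}+C_{2g+1}$, and furthermore \[ 1-\frac{1}{r-1} < 1-\frac{1}{r-1+2/(2g-1)} \le \delta_H \le 1-\frac{1}{r-1/3}. \]
   Context: All graphs are finite and simple. $K_m$ is the complete graph on $m$ vertices ($K_0$ is empty), $C_m$ the $m$-cycle; the join $G+F$ is obtained from disjoint copies of $G$ and $F$ by joining every vertex of $G$ to every vertex of $F$. $H$ is homomorphic to $F$ if there is a map $V(H)\to V(F)$ sending edges to edges. $\delta(G)$ is minimum degree; $G$ is $H$-free if it contains no subgraph isomorphic to $H$. For a graph $H$ of chromatic number $r+1$, $\delta_H$ is the infimum of all $c$ such that for every $\eta>0$ there is $n_0$ such that every $H$-free graph $G$ on $n\ge n_0$ vertices with $\delta(G)\ge cn$ can be made $r$-partite by deleting at most $\eta n^2$ edges. -}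

module Defs where

open import Data.Nat as ℕ using (ℕ; zero; suc; _∸_; _≤_; _<_)
open import Data.Nat.DivMod using (_%_)
open import Data.Integer using (+_)
open import Data.Rational as ℚ using (ℚ; 0ℚ; 1ℚ; 1/_; ≢-nonZero)
open import Data.Rational.Properties using () renaming (_≟_ to _≟ℚ_)
open import Data.Fin using (Fin; toℕ; splitAt)
open import Data.Bool using (Bool; true; false; _∧_; not; if_then_else_)
open import Data.Sum using (_⊎_; inj₁; inj₂)
open import Data.Product using (Σ; _×_; _,_; ∃)
open import Relation.Nullary using (¬_; yes; no; Dec)
open import Relation.Nullary.Decidable using (⌊_⌋)
open import Relation.Binary.PropositionalEquality using (_≡_)
open import Function.Definitions using (Injective)

record Graph : Set where
  field
    size : ℕ
    adj  : Fin size → Fin size → Bool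
open Graph public

IsSimple : Graph → Set
IsSimple G = (∀ u v → adj G u v ≡ adj G v u) × (∀ u → adj G u u ≡ false)

Hom : Graph → Graph → Set
Hom H F = Σ (Fin (size H) → Fin (size F)) λ f →
  ∀ u v → adj H u v ≡ true → adj F (f u) (f v) ≡ true

ContainsSub : Graph → Graph → Set
ContainsSub G H = Σ (Fin (size H) → Fin (size G)) λ f →
  Injective _≡_ _≡_ f × (∀ u v → adj H u v ≡ true → adj G (f u) (f v) ≡ true)

_-free : Graph → Graph → Set
(H -free) G = ¬ ContainsSub G H

K : ℕ → Graph
K m = record { size = m ; adj = λ u v → not ⌊ u Data.Fin.≟ v ⌋ }

-- cycle C_m (for m ≥ 3): i ~ j iff j ≡ i+1 (mod m) or i ≡ j+1 (mod m)
stepC : (m : ℕ) → Fin m → Fin m → Bool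
stepC zero    u v = false
stepC (suc k) u v = ⌊ (suc (toℕ u) % suc k) ℕ.≟ toℕ v ⌋

C : ℕ → Graph
C m = record { size = m ; adj = λ u v → stepC m u v Data.Bool.∨ stepC m v u }

_⊕_ : Graph → Graph → Graph
G ⊕ F = record { size = size G ℕ.+ size F ; adj = a }
  where
  a : Fin (size G ℕ.+ size F) → Fin (size G ℕ.+ size F) → Bool
  a u v with splitAt (size G) u | splitAt (size G) v
  ... | inj₁ x | inj₁ y = adj G x y
  ... | inj₂ x | inj₂ y = adj F x y
  ... | inj₁ _ | inj₂ _ = true
  ... | inj₂ _ | inj₁ _ = true

-- H has chromatic number k: properly k-colourable but not (k-1)-colourable
-- (a proper k-colouring is a homomorphism to K_k)
ChromaticNumber : Graph → ℕ → Set
ChromaticNumber H k = Hom H (K k) × ¬ Hom H (K (k ∸ 1))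

count : ∀ {n} → (Fin n → Bool) → ℕ
count {zero}  p = 0
count {suc n} p = (if p Fin.zero then 1 else 0) ℕ.+ count (λ i → p (Fin.suc i))
  where import Data.Fin as Fin

degree : (G : Graph) → Fin (size G) → ℕ
degree G v = count (adj G v)

sumFin : ∀ {n} → (Fin n → ℕ) → ℕ
sumFin {zero}  f = 0
sumFin {suc n} f = f Fin.zero ℕ.+ sumFin (λ i → f (Fin.suc i))
  where import Data.Fin as Fin

edges : Graph → ℕ
edges G = sumFin λ u → count (λ v → ⌊ toℕ u ℕ.<? toℕ v ⌋ ∧ adj G u v)

ℕ→ℚ : ℕ → ℚ
ℕ→ℚ n = (+ n) ℚ./ 1

-- reciprocal, total (1/0 := 0; only ever applied to nonzero arguments here)
inv : ℚ → ℚ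
inv q with q ≟ℚ 0ℚ
... | yes _ = 0ℚ
... | no q≢0 = (1/ q) {{≢-nonZero q≢0}}

ApproxPartite : Graph → ℕ → ℚ → Set
ApproxPartite G r η = Σ (Fin (size G) → Fin (size G) → Bool) λ a′ →
  let G′ = record { size = size G ; adj = a′ } in
  IsSimple G′ × (∀ u v → a′ u v ≡ true → adj G u v ≡ true) × Hom G′ (K r) ×
  (ℕ→ℚ (edges G ∸ edges G′) ℚ.≤ η ℚ.* (ℕ→ℚ (size G) ℚ.* ℕ→ℚ (size G)))

-- c belongs to the set whose infimum is δ_H (for H of chromatic number r+1):
-- for every η > 0 there is n₀ such that every H-free graph G on n ≥ n₀ vertices
-- with δ(G) ≥ c n can be made r-partite by deleting at most η n² edges.
Works : Graph → ℕ → ℚ → Set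
Works H r c = ∀ (η : ℚ) → 0ℚ ℚ.< η → ∃ λ n₀ → ∀ (G : Graph) → IsSimple G →
  n₀ ≤ size G → (H -free) G →
  (∀ v → c ℚ.* ℕ→ℚ (size G) ℚ.≤ ℕ→ℚ (degree G v)) →
  ApproxPartite G r η

-- δ_H ≥ L   (no c < L works; the set is upward closed)
δ≥ : Graph → ℕ → ℚ → Set
δ≥ H r L = ∀ c → c ℚ.< L → ¬ Works H r c

δ≤ : Graph → ℕ → ℚ → Set
δ≤ H r U = ∀ c → U ℚ.< c → Works H r c

{-# OPTIONS --safe #-}
module Submission where

open import Defs
open import Data.Nat using (ℕ; _≤_; _<_; _∸_; _*_; suc; _+_)
open import Data.Rational as ℚ using (ℚ; 1ℚ)
open import Data.Product using (Σ; _×_)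
open import Relation.Nullary using (¬_)
open import Data.Nat using (zero; _^_; _≤?_; _<?_; _⊔_; z≤n; s≤s; s≤s⁻¹; NonZero; >-nonZero; >-nonZero⁻¹)
open import Data.Nat.Properties
open import Data.Nat.DivMod using (_%_; m<n⇒m%n≡m; n%n≡0)
open import Data.Nat.ListAction using (sum)
open import Data.Nat.Tactic.RingSolver using (solve-∀)
import Data.Integer as ℤ
import Data.Integer.Properties as ℤₚ
open import Data.Rational using (0ℚ; mkℚ; toℚᵘ)
import Data.Rational.Properties as ℚₚ
open import Data.Rational.Solver using (module +-*-Solver)
open import Data.Rational.Unnormalised as ℚᵘ using (mkℚᵘ)
import Data.Rational.Unnormalised.Properties as ℚᵘₚ
open import Data.Bool using (Bool; true; false; _∧_; _∨_; _xor_; not; if_then_else_)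
import Data.Bool as Bool
open import Data.Bool.ListAction using (all)
open import Data.Bool.Properties using (∨-zeroʳ; ∨-comm)
open import Data.Empty using (⊥; ⊥-elim)
open import Data.Fin using (Fin; zero; suc; toℕ; fromℕ<; splitAt; join; _↑ˡ_; _↑ʳ_)
import Data.Fin as Fin
open import Data.Fin.Properties using (any?; all?; ¬∀⟶∃¬; ↑ʳ-injective; toℕ-injective; toℕ<n; toℕ-fromℕ<; splitAt-↑ˡ; splitAt-↑ʳ; join-splitAt; pigeonhole; finToFun-funToFin)
open import Data.List using (List; []; _∷_; _++_; length; map; filter; tabulate; lookup; take; allFin)
open import Data.List.Properties using (length-take; length-++; filter-all)
open import Data.List.Membership.Propositional using (_∈_)
open import Data.List.Membership.Propositional.Properties using (∈-lookup; ∈-filter⁺; ∈-filter⁻; ∈-++⁻)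
import Data.List.Membership.DecPropositional as DecMembership
open import Data.List.Relation.Binary.Subset.Propositional using (_⊆_)
open import Data.List.Relation.Binary.Subset.Propositional.Properties using (∷⁺ʳ)
open import Data.List.Relation.Unary.All using (All; []; _∷_)
import Data.List.Relation.Unary.All as All
import Data.List.Relation.Unary.All.Properties as Allₚ
open import Data.List.Relation.Unary.AllPairs using (AllPairs; []; _∷_; allPairs?)
import Data.List.Relation.Unary.AllPairs.Properties as AllPairsₚ
open import Data.List.Relation.Unary.Any using (here; there; index)
open import Data.List.Relation.Unary.Any.Properties using (lookup-index)
open import Data.List.Relation.Unary.Unique.Propositional using (Unique)
import Data.List.Relation.Unary.Unique.Propositional.Properties as Uniqueₚ
open import Data.Product using (_,_; ∃; proj₁; proj₂)
open import Data.Sum using (_⊎_; inj₁; inj₂)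
open import Function using (_∘_; id)
open import Function.Definitions using (Injective)
open import Relation.Nullary using (Dec; yes; no; contradiction)
open import Relation.Nullary.Decidable using (⌊_⌋; map′; _×-dec_; _→-dec_)
open import Relation.Binary.PropositionalEquality using (_≡_; _≢_; refl; sym; trans; cong; cong₂; subst; subst₂; subst-injective; module ≡-Reasoning)

-- Least g: a homomorphism into K_{r-2} + C_{2g+1} misses a cycle vertex once 2g + 1 > |H|, and
-- K_{r-2} joined to a path is r-colourable.
--
-- Lower bound: blow up K_{r-2} + C_{2g+1} with weight 2g - 1 on the clique vertices and 1 on the cycle
-- vertices. The majority colours of an r-partite subgraph would colour K_{r-2} + C_{2g+1} unless a positive
-- proportion of all pairs is lost, and an odd cycle joined to K_{r-2} is not r-colourable.
--
-- Upper bound: no removal lemma is needed. By the box theorem an H-free graph contains few K_{r+1}.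
-- If every vertex has fewer than 3n/(3r-1) non-neighbours, two local extension arguments work for a positive
-- proportion of all vertices w at each step:
-- (1) given an r-clique z and a vertex x, vertices of z can be exchanged for neighbours of x until an
--     (r-1)-clique lies in the common neighbourhood of x and some z_i: this puts x into class i;
-- (2) if x ~ y and both x and y have such cliques Q, Q' with the same v = z_i, then Q ∩ Q' can be enlarged
--     one vertex at a time (Brandt's proof of the Andrásfai-Erdős-Sós theorem) until x, y and Q = Q' form K_{r+1}.
-- Hence an edge inside a class yields a positive proportion of tuples containing K_{r+1}, and averaging over z
-- gives an r-clique whose classes span few edges.

-- Finite sums

-- The upper bound is the Andrásfai-Erdős-Sós threshold for K_{r+1}: 1 - 1/(r - 1/3) equals 1 -
-- 3/(3r - 1), and 3r - 1 is the largest weight that the auxiliary list of vertices reaches in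
-- Brandt's argument. In a K_{r+1}-free graph it would suffice to find one suitable vertex w at each
-- step. An H-free graph may contain K_{r+1}, only rarely, so a single w proves nothing. The strict
-- inequality between the degree ratio and the threshold leaves a slack linear in n in every
-- averaging, and this slack turns "some w" into "at least n/c vertices w". The number of steps
-- depends on r alone, so a chain of them still yields a fixed proportion of all tuples. In the code
-- the number of parts is mostly written `2 + r`: the rare cliques have `3 + r` vertices, and the
-- clique in the graph that is blown up has r.

ind : Bool → ℕ
ind b = if b then 1 else 0

ind-mono : ∀ {a b} → (a ≡ true → b ≡ true) → ind a ≤ ind b
ind-mono {false}         _ = z≤n
ind-mono {true}  {true}  _ = ≤-refl
ind-mono {true}  {false} h with h refl
... | ()

ind≤1 : ∀ b → ind b ≤ 1
ind≤1 true  = ≤-refl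
ind≤1 false = z≤n

ind-∨ : ∀ a b → ind (a ∨ b) ≤ ind a + ind b
ind-∨ true  b = s≤s z≤n
ind-∨ false b = ≤-refl

sum-cong : ∀ {n} {f g : Fin n → ℕ} → (∀ i → f i ≡ g i) → sumFin f ≡ sumFin g
sum-cong {zero}  h = refl
sum-cong {suc n} h = cong₂ _+_ (h zero) (sum-cong (h ∘ suc))

sum-mono : ∀ {n} {f g : Fin n → ℕ} → (∀ i → f i ≤ g i) → sumFin f ≤ sumFin g
sum-mono {zero}  h = z≤n
sum-mono {suc n} h = +-mono-≤ (h zero) (sum-mono (h ∘ suc))

interchange : ∀ a b c d → (a + b) + (c + d) ≡ (a + c) + (b + d)
interchange = solve-∀

sum-+ : ∀ {n} (f g : Fin n → ℕ) → sumFin (λ i → f i + g i) ≡ sumFin f + sumFin g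
sum-+ {zero}  f g = refl
sum-+ {suc n} f g = trans (cong (f zero + g zero +_) (sum-+ (f ∘ suc) (g ∘ suc)))
                          (interchange (f zero) (g zero) _ _)

sum-* : ∀ {n} c (f : Fin n → ℕ) → sumFin (λ i → c * f i) ≡ c * sumFin f
sum-* {zero}  c f = sym (*-zeroʳ c)
sum-* {suc n} c f = trans (cong (c * f zero +_) (sum-* c (f ∘ suc))) (sym (*-distribˡ-+ c (f zero) _))

sum-const : ∀ n c → sumFin {n} (λ _ → c) ≡ n * c
sum-const zero    c = refl
sum-const (suc n) c = cong (c +_) (sum-const n c)

sum-swap : ∀ {m n} (f : Fin m → Fin n → ℕ) →
  sumFin (λ i → sumFin (f i)) ≡ sumFin (λ j → sumFin (λ i → f i j))
sum-swap {zero}  {n} f = sym (trans (sum-const n 0) (*-zeroʳ n))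
sum-swap {suc m} {n} f = trans (cong (sumFin (f zero) +_) (sum-swap (f ∘ suc)))
                               (sym (sum-+ (f zero) (λ j → sumFin (λ i → f (suc i) j))))

count≡sum : ∀ {n} (p : Fin n → Bool) → count p ≡ sumFin (ind ∘ p)
count≡sum {zero}  p = refl
count≡sum {suc n} p = cong (ind (p zero) +_) (count≡sum (p ∘ suc))

sum-split : ∀ m n (f : Fin (m + n) → ℕ) →
  sumFin f ≡ sumFin (λ i → f (i ↑ˡ n)) + sumFin (λ j → f (m ↑ʳ j))
sum-split zero    n f = refl
sum-split (suc m) n f = trans (cong (f zero +_) (sum-split m n (f ∘ suc))) (sym (+-assoc (f zero) _ _))

term≤sum : ∀ {n} (f : Fin n → ℕ) i → f i ≤ sumFin f
term≤sum f zero    = m≤m+n _ _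
term≤sum f (suc i) = ≤-trans (term≤sum (f ∘ suc) i) (m≤n+m _ _)

-- Serves as the pigeonhole principle for majority colours and for indices; the argument in `Fin n`
-- only excludes `n = 0`.
sum≤max : ∀ {n} (f : Fin n → ℕ) → Fin n → ∃ λ i → sumFin f ≤ n * f i
sum≤max {suc zero}    f _ = zero , ≤-refl
sum≤max {suc (suc n)} f _ with sum≤max (f ∘ suc) zero
... | i , h with f zero ≤? f (suc i)
... | yes p = suc i , +-mono-≤ p h
... | no ¬p = zero , +-monoʳ-≤ (f zero) (≤-trans h (*-monoʳ-≤ (suc n) (<⇒≤ (≰⇒> ¬p))))

δ= : ∀ {n} → Fin n → Fin n → ℕ
δ= i j = ind ⌊ i Fin.≟ j ⌋

δ=-suc : ∀ {n} (i j : Fin n) → δ= (suc i) (suc j) ≡ δ= i j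
δ=-suc i j with i Fin.≟ j
... | yes _ = refl
... | no  _ = refl

sum-δ : ∀ {n} (f : Fin n → ℕ) i → sumFin (λ j → f j * δ= i j) ≡ f i
sum-δ {suc n} f zero = begin
  f zero * 1 + sumFin (λ j → f (suc j) * 0)  ≡⟨ cong₂ _+_ (*-identityʳ _) (sum-cong (λ j → *-zeroʳ (f (suc j)))) ⟩
  f zero + sumFin {n} (λ _ → 0)              ≡⟨ cong (f zero +_) (trans (sum-const n 0) (*-zeroʳ n)) ⟩
  f zero + 0                                 ≡⟨ +-identityʳ _ ⟩
  f zero                                     ∎
  where open ≡-Reasoning
sum-δ {suc n} f (suc i) = trans
  (cong₂ _+_ (*-zeroʳ (f zero)) (sum-cong (λ j → cong (f (suc j) *_) (δ=-suc i j))))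
  (sum-δ (f ∘ suc) i)

-- Sum over all a-tuples, repetitions included. Tuples are lists, so that predicates on tuples of
-- different lengths can be compared through `⊆`.
sumL : ∀ {n} (a : ℕ) → (List (Fin n) → ℕ) → ℕ
sumL zero    f = f []
sumL (suc a) f = sumFin λ x → sumL a (λ t → f (x ∷ t))

sumL-mono : ∀ {n} a {f g : List (Fin n) → ℕ} → (∀ t → length t ≡ a → f t ≤ g t) → sumL a f ≤ sumL a g
sumL-mono zero    h = h [] refl
sumL-mono (suc a) h = sum-mono λ x → sumL-mono a λ t e → h (x ∷ t) (cong suc e)

sumL-cong : ∀ {n} a {f g : List (Fin n) → ℕ} → (∀ t → f t ≡ g t) → sumL a f ≡ sumL a g
sumL-cong zero    h = h []
sumL-cong (suc a) h = sum-cong λ x → sumL-cong a λ t → h (x ∷ t)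

sumL-+ : ∀ {n} a (f g : List (Fin n) → ℕ) → sumL a (λ t → f t + g t) ≡ sumL a f + sumL a g
sumL-+ zero    f g = refl
sumL-+ (suc a) f g = trans (sum-cong λ x → sumL-+ a (f ∘ (x ∷_)) (g ∘ (x ∷_)))
                           (sum-+ (λ x → sumL a (f ∘ (x ∷_))) (λ x → sumL a (g ∘ (x ∷_))))

sumL-* : ∀ {n} a c (f : List (Fin n) → ℕ) → sumL a (λ t → c * f t) ≡ c * sumL a f
sumL-* zero    c f = refl
sumL-* (suc a) c f = trans (sum-cong λ x → sumL-* a c (f ∘ (x ∷_))) (sum-* c (λ x → sumL a (f ∘ (x ∷_))))

sumL-const : ∀ {n} a c → sumL {n} a (λ _ → c) ≡ n ^ a * c
sumL-const     zero    c = sym (+-identityʳ c)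
sumL-const {n} (suc a) c = trans (sum-cong {n} λ x → sumL-const a c)
                                 (trans (sum-const n _) (sym (*-assoc n (n ^ a) c)))

sumL-swap : ∀ {n m} a (f : Fin m → List (Fin n) → ℕ) →
  sumL a (λ t → sumFin (λ w → f w t)) ≡ sumFin (λ w → sumL a (f w))
sumL-swap zero    f = refl
sumL-swap (suc a) f = trans (sum-cong λ x → sumL-swap a (λ w t → f w (x ∷ t)))
                            (sum-swap (λ x w → sumL a (λ t → f w (x ∷ t))))

sum-pick : ∀ {n} (f g : Fin n → ℕ) → sumFin f < sumFin g → ∃ λ i → f i < g i
sum-pick {suc n} f g h with f zero Data.Nat.<? g zero
... | yes p = zero , p
... | no ¬p = let i , q = sum-pick (f ∘ suc) (g ∘ suc)
                            (+-cancelˡ-< (g zero) _ _ (≤-<-trans (+-monoˡ-≤ _ (≮⇒≥ ¬p)) h))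
              in suc i , q

sumL-pick : ∀ {n} a (f g : List (Fin n) → ℕ) → sumL a f < sumL a g → ∃ λ t → length t ≡ a × f t < g t
sumL-pick zero    f g h = [] , refl , h
sumL-pick (suc a) f g h with sum-pick _ _ h
... | x , h′ with sumL-pick a _ _ h′
... | t , e , q = x ∷ t , cong suc e , q

-- Sublists and the box theorem

⌊⌋⁺ : ∀ {P : Set} (d : Dec P) → P → ⌊ d ⌋ ≡ true
⌊⌋⁺ (yes _) _ = refl
⌊⌋⁺ (no ¬p) p = contradiction p ¬p

⌊⌋⁻ : ∀ {P : Set} (d : Dec P) → ⌊ d ⌋ ≡ true → P
⌊⌋⁻ (yes p) _ = p

∨⁻ : ∀ a b → a ∨ b ≡ true → a ≡ true ⊎ b ≡ true
∨⁻ true  b e = inj₁ refl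
∨⁻ false b e = inj₂ e

∨⁺ˡ : ∀ {a b} → a ≡ true → a ∨ b ≡ true
∨⁺ˡ refl = refl

∨⁺ʳ : ∀ a {b} → b ≡ true → a ∨ b ≡ true
∨⁺ʳ a refl = ∨-zeroʳ a

∧⁻ : ∀ a b → a ∧ b ≡ true → a ≡ true × b ≡ true
∧⁻ true b e = refl , e

-- A Boolean, so that its indicator can be summed. Entries already chosen are absorbed into the
-- predicate.
someSublist : ∀ {A : Set} → (List A → Bool) → ℕ → List A → Bool
someSublist P zero    t       = P []
someSublist P (suc s) []      = false
someSublist P (suc s) (w ∷ t) = someSublist (P ∘ (w ∷_)) s t ∨ someSublist P (suc s) t

someSublist-sound : ∀ {A : Set} (P : List A → Bool) s t → someSublist P s t ≡ true →
  ∃ λ Q → length Q ≡ s × P Q ≡ true × Q ⊆ t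
someSublist-sound P zero    t       h = [] , refl , h , λ ()
someSublist-sound P (suc s) (w ∷ t) h with ∨⁻ (someSublist (P ∘ (w ∷_)) s t) _ h
... | inj₁ h₁ = let Q , l , p , i = someSublist-sound (P ∘ (w ∷_)) s t h₁ in
                w ∷ Q , cong suc l , p , λ { (here e) → here e ; (there q) → there (i q) }
... | inj₂ h₂ = let Q , l , p , i = someSublist-sound P (suc s) t h₂ in Q , l , p , there ∘ i

someSublist-filter : ∀ {A : Set} (g : A → Bool) (P : List A → Bool) →
  (∀ Z → All (λ z → g z ≡ true) Z → P Z ≡ true) →
  ∀ s t → s ≤ sum (map (ind ∘ g) t) → someSublist P s t ≡ true
someSublist-filter g P h zero    t       _ = h [] []
someSublist-filter g P h (suc s) (w ∷ t) l with g w in e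
... | true  rewrite someSublist-filter g (P ∘ (w ∷_)) (λ Z a → h (w ∷ Z) (e ∷ a)) s t (s≤s⁻¹ l) = refl
... | false rewrite someSublist-filter g P h (suc s) t l = ∨-zeroʳ _

-- A fixed s-tuple occupies a fixed set of s positions in `n ^ (N ∸ s)` of the N-tuples, and there
-- are at most `2 ^ N` sets of positions. The induction is Pascal's rule; the factor `n ^ s` on the
-- left avoids the subtraction.
someSublist-count : ∀ {n} (P : List (Fin n) → Bool) N s →
  n ^ s * sumL N (λ t → ind (someSublist P s t)) ≤ 2 ^ N * (n ^ N * sumL s (λ t → ind (P t)))
someSublist-count {n} P N zero = begin
  1 * sumL N (λ _ → ind (P []))  ≡⟨ *-identityˡ _ ⟩
  sumL N (λ _ → ind (P []))      ≡⟨ sumL-const N _ ⟩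
  n ^ N * ind (P [])             ≤⟨ m≤m*n _ (2 ^ N) {{m^n≢0 2 N}} ⟩
  n ^ N * ind (P []) * 2 ^ N     ≡⟨ *-comm _ (2 ^ N) ⟩
  2 ^ N * (n ^ N * ind (P []))   ∎
  where open ≤-Reasoning
someSublist-count {n} P zero (suc s) = ≤-trans (≤-reflexive (*-zeroʳ (n ^ suc s))) z≤n
someSublist-count {n} P (suc N) (suc s) = begin
  n * n ^ s * sumFin (λ x → sumL N (λ t → ind (someSublist (P ∘ (x ∷_)) s t ∨ someSublist P (suc s) t)))
    ≤⟨ *-monoʳ-≤ (n * n ^ s) (sum-mono λ x → sumL-mono N λ t _ → ind-∨ (someSublist (P ∘ (x ∷_)) s t) _) ⟩
  n * n ^ s * sumFin (λ x → sumL N (λ t → ind (someSublist (P ∘ (x ∷_)) s t) + ind (someSublist P (suc s) t)))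
    ≡⟨ cong (n * n ^ s *_) (sum-cong {n} λ x → sumL-+ N (λ t → ind (someSublist (P ∘ (x ∷_)) s t)) (λ t → ind (someSublist P (suc s) t))) ⟩
  n * n ^ s * sumFin (λ x → a x + b)
    ≡⟨ cong (n * n ^ s *_) (trans (sum-+ a (λ _ → b)) (cong (sumFin a +_) (sum-const n b))) ⟩
  n * n ^ s * (sumFin a + n * b)
    ≡⟨ rearrange n (n ^ s) (sumFin a) b ⟩
  n * (n ^ s * sumFin a) + n * (n ^ suc s * b)
    ≤⟨ +-mono-≤ (*-monoʳ-≤ n first) (*-monoʳ-≤ n (someSublist-count P N (suc s))) ⟩
  n * (2 ^ N * (n ^ N * c)) + n * (2 ^ N * (n ^ N * c))
    ≡⟨ collect n (2 ^ N) (n ^ N) c ⟩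
  2 * 2 ^ N * (n * n ^ N * c) ∎
  where
  open ≤-Reasoning
  a : Fin n → ℕ
  a x = sumL N (λ t → ind (someSublist (P ∘ (x ∷_)) s t))
  b c : ℕ
  b = sumL N (λ t → ind (someSublist P (suc s) t))
  c = sumL (suc s) (λ t → ind (P t))
  rearrange : ∀ n k a b → n * k * (a + n * b) ≡ n * (k * a) + n * (n * k * b)
  rearrange = solve-∀
  collect : ∀ n k m c → n * (k * (m * c)) + n * (k * (m * c)) ≡ 2 * k * (n * m * c)
  collect = solve-∀
  first : n ^ s * sumFin a ≤ 2 ^ N * (n ^ N * c)
  first = begin
    n ^ s * sumFin a                      ≡⟨ sum-* (n ^ s) a ⟨
    sumFin (λ x → n ^ s * a x)            ≤⟨ sum-mono (λ x → someSublist-count (P ∘ (x ∷_)) N s) ⟩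
    sumFin (λ x → 2 ^ N * (n ^ N * d x))  ≡⟨ trans (sum-* (2 ^ N) (λ x → n ^ N * d x)) (cong (2 ^ N *_) (sum-* (n ^ N) d)) ⟩
    2 ^ N * (n ^ N * c)                   ∎
    where
    d : Fin n → ℕ
    d x = sumL s (λ t → ind (P (x ∷ t)))

-- `Y` has at most `2 ^ length Y` subsets, so one of them serves at least that fraction of the
-- tuples: for each y in turn the larger of the two branches, with or without y, is followed.
-- Positivity rules out ending with `Y` empty and elements still to be chosen.
someSublist-pigeonhole : ∀ {n} {A : Set} a (P : List (Fin n) → List A → Bool) h Y → Unique Y →
  0 < sumL a (λ t → ind (someSublist (P t) h Y)) →
  ∃ λ Z → Z ⊆ Y × Unique Z × length Z ≡ h ×
    sumL a (λ t → ind (someSublist (P t) h Y)) ≤ 2 ^ length Y * sumL a (λ t → ind (P t Z))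
someSublist-pigeonhole a P zero Y u pos = [] , (λ ()) , [] , refl , m≤n*m _ (2 ^ length Y) {{m^n≢0 2 (length Y)}}
someSublist-pigeonhole {n} a P (suc h) [] u pos =
  contradiction (subst (0 <_) (trans (sumL-const {n} a 0) (*-zeroʳ (n ^ a))) pos) λ ()
someSublist-pigeonhole {n} a P (suc h) (y ∷ Y) (y∉ ∷ u) pos = cases
  where
  c c₁ c₂ : ℕ
  c  = sumL a (λ t → ind (someSublist (P t) (suc h) (y ∷ Y)))
  c₁ = sumL a (λ t → ind (someSublist (P t ∘ (y ∷_)) h Y))
  c₂ = sumL a (λ t → ind (someSublist (P t) (suc h) Y))
  c≤ : c ≤ c₁ + c₂
  c≤ = ≤-trans (sumL-mono a λ t _ → ind-∨ (someSublist (P t ∘ (y ∷_)) h Y) _) (≤-reflexive (sumL-+ a _ _))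
  double : ∀ {c d k} → c ≤ d + d → d ≤ 2 ^ length Y * k → c ≤ 2 ^ suc (length Y) * k
  double {k = k} p q = ≤-trans p (≤-trans (+-mono-≤ q q) (≤-reflexive (dist (2 ^ length Y) k)))
    where
    dist : ∀ m k → m * k + m * k ≡ 2 * m * k
    dist = solve-∀
  positive : ∀ {d} → c ≤ d + d → 0 < d
  positive {zero}  p = contradiction (≤-trans pos p) λ ()
  positive {suc d} p = s≤s z≤n
  cases : ∃ λ Z → Z ⊆ (y ∷ Y) × Unique Z × length Z ≡ suc h ×
    c ≤ 2 ^ suc (length Y) * sumL a (λ t → ind (P t Z))
  cases with c₂ ≤? c₁
  ... | yes p = let q = ≤-trans c≤ (+-monoʳ-≤ c₁ p)
                    Z , i , uZ , l , b = someSublist-pigeonhole a (λ t → P t ∘ (y ∷_)) h Y u (positive q)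
                in y ∷ Z , (λ { (here e) → here e ; (there z) → there (i z) })
                 , All.tabulate (λ z → All.lookup y∉ (i z)) ∷ uZ , cong suc l , double {k = sumL a (λ t → ind (P t (y ∷ Z)))} q b
  ... | no ¬p = let q = ≤-trans c≤ (+-monoˡ-≤ c₂ (<⇒≤ (≰⇒> ¬p)))
                    Z , i , uZ , l , b = someSublist-pigeonhole a P (suc h) Y u (positive q)
                in Z , there ∘ i , uZ , l , double {k = sumL a (λ t → ind (P t Z))} q b

lookup-injective : ∀ {A : Set} {xs : List A} → Unique xs → ∀ i j → lookup xs i ≡ lookup xs j → i ≡ j
lookup-injective (_ ∷ u) zero    zero    e = refl
lookup-injective (p ∷ u) zero    (suc j) e = contradiction e (All.lookup p (∈-lookup j))
lookup-injective (p ∷ u) (suc i) zero    e = contradiction (sym e) (All.lookup p (∈-lookup i))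
lookup-injective (_ ∷ u) (suc i) (suc j) e = cong suc (lookup-injective u i j e)

enumerate : ∀ {A : Set} {h} (Z : List A) → Unique Z → length Z ≡ h →
  Σ (Fin h → A) λ f → Injective _≡_ _≡_ f × (∀ j → f j ∈ Z)
enumerate Z u refl = lookup Z , (λ {i} {j} → lookup-injective u i j) , ∈-lookup

length-filter-tabulate : ∀ {A : Set} {n} (p : A → Bool) (f : Fin n → A) →
  length (filter (λ x → p x Bool.≟ true) (tabulate f)) ≡ sumFin (λ i → ind (p (f i)))
length-filter-tabulate {n = zero}  p f = refl
length-filter-tabulate {n = suc n} p f with p (f zero)
... | true  = cong suc (length-filter-tabulate p (f ∘ suc))
... | false = length-filter-tabulate p (f ∘ suc)

choose : ∀ {n} (p : Fin n → Bool) M → M ≤ sumFin (ind ∘ p) →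
  ∃ λ Y → Unique Y × length Y ≡ M × All (λ y → p y ≡ true) Y
choose {n} p M M≤ =
  take M L , Uniqueₚ.take⁺ M (Uniqueₚ.filter⁺ p? (Uniqueₚ.allFin⁺ n)) ,
  trans (length-take M L) (m≤n⇒m⊓n≡m (subst (M ≤_) (sym (length-filter-tabulate p (λ i → i))) M≤)) ,
  Allₚ.take⁺ M (Allₚ.all-filter p? (allFin n))
  where
  p? = λ x → p x Bool.≟ true
  L = filter p? (allFin n)

all⁺ : ∀ {A : Set} (p : A → Bool) {Z} → All (λ z → p z ≡ true) Z → all p Z ≡ true
all⁺ p []           = refl
all⁺ p (pz ∷ pZ) rewrite pz = all⁺ p pZ

all⁻ : ∀ {A : Set} (p : A → Bool) {Z z} → all p Z ≡ true → z ∈ Z → p z ≡ true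
all⁻ p {y ∷ Z} h (here refl) = proj₁ (∧⁻ (p y) _ h)
all⁻ p {y ∷ Z} h (there z∈)  = all⁻ p (proj₂ (∧⁻ (p y) _ h)) z∈

sum-ind≤length : ∀ {A : Set} (g : A → Bool) Y → sum (map (ind ∘ g) Y) ≤ length Y
sum-ind≤length g []      = z≤n
sum-ind≤length g (y ∷ Y) = +-mono-≤ (ind≤1 (g y)) (sum-ind≤length g Y)

sum-map-sumL : ∀ {n} {A : Set} a (F : A → List (Fin n) → ℕ) Y →
  sum (map (λ y → sumL a (F y)) Y) ≡ sumL a (λ t → sum (map (λ y → F y t) Y))
sum-map-sumL {n} a F []      = sym (trans (sumL-const {n} a 0) (*-zeroʳ (n ^ a)))
sum-map-sumL     a F (y ∷ Y) = trans (cong (sumL a (F y) +_) (sum-map-sumL a F Y)) (sym (sumL-+ a (F y) _))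

sum-map-lower : ∀ {A : Set} (f : A → ℕ) c k Y → All (λ y → k ≤ c * f y) Y → length Y * k ≤ c * sum (map f Y)
sum-map-lower f c k []      []       = z≤n
sum-map-lower f c k (y ∷ Y) (p ∷ ps) =
  ≤-trans (+-mono-≤ p (sum-map-lower f c k Y ps)) (≤-reflexive (sym (*-distribˡ-+ c (f y) _)))

-- Boxes in dense sets of s-tuples

Box : ∀ {n} → (List (Fin n) → Bool) → ℕ → ℕ → Set
Box {n} P s h = Σ (Fin s → Fin h → Fin n) λ f → (∀ i → Injective _≡_ _≡_ (f i)) ×
  (∀ (c : Fin s → Fin h) → P (tabulate λ i → f i (c i)) ≡ true)

-- Averaging twice. At least n/E vertices x have at least `n ^ s / E` extensions t each; over M such
-- vertices a tuple t is on average extended by at least h + 1 of them, and fixing the h-subset `Z`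
-- costs a factor `2 ^ M`. Here `E = 2 e` halves the density, `M = E (h + 1)` produces that average,
-- and `E * M ≤ n` ensures that M popular vertices exist.
box-step : ∀ {n} (P : List (Fin n) → Bool) s h e E M → .{{_ : NonZero E}} → E ≡ 2 * e → M ≡ E * suc h →
  1 ≤ n → E * M ≤ n →
  n ^ suc s < e * sumL (suc s) (λ t → ind (P t)) →
  ∃ λ Z → Unique Z × length Z ≡ h ×
    n ^ s < suc (M * 2 ^ M) * sumL s (λ t → ind (all (λ z → P (z ∷ t)) Z))
box-step {n} P s h e E M E≡ M≡ n≥1 n≥ dense = conclude
  where
  open ≤-Reasoning
  instance
    n≢0 : NonZero n
    n≢0 = >-nonZero n≥1
    ns≢0 : NonZero (n ^ s)
    ns≢0 = m^n≢0 n s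
  f : Fin n → ℕ
  f x = sumL s (λ t → ind (P (x ∷ t)))
  f≤ : ∀ x → f x ≤ n ^ s
  f≤ x = ≤-trans (sumL-mono s λ t _ → ind≤1 (P (x ∷ t)))
                 (≤-reflexive (trans (sumL-const {n} s 1) (*-identityʳ _)))
  popular : Fin n → Bool
  popular x = ⌊ n ^ s ≤? E * f x ⌋
  -- Unpopular vertices contribute at most `n ^ s` each, hence at most half of the total, because
  -- `E` is twice `e`.
  pointwise : ∀ x → E * f x ≤ n ^ s + E * n ^ s * ind (popular x)
  pointwise x with n ^ s ≤? E * f x
  ... | yes _ = ≤-trans (*-monoʳ-≤ E (f≤ x)) (≤-trans (≤-reflexive (sym (*-identityʳ _))) (m≤n+m _ (n ^ s)))
  ... | no ¬p = ≤-trans (<⇒≤ (≰⇒> ¬p)) (m≤m+n _ _)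
  pop : ℕ
  pop = sumFin (ind ∘ popular)
  n≤pop : n ≤ E * pop
  n≤pop = *-cancelʳ-≤ n (E * pop) (n ^ s) (+-cancelˡ-≤ (n * n ^ s) _ _ (begin
    n * n ^ s + n * n ^ s              ≡⟨ cong (n * n ^ s +_) (sym (+-identityʳ _)) ⟩
    2 * (n * n ^ s)                    ≤⟨ *-monoʳ-≤ 2 (<⇒≤ dense) ⟩
    2 * (e * sumFin f)                 ≡⟨ *-assoc 2 e _ ⟨
    2 * e * sumFin f                   ≡⟨ cong (_* sumFin f) E≡ ⟨
    E * sumFin f                       ≡⟨ sum-* E f ⟨
    sumFin (λ x → E * f x)             ≤⟨ sum-mono pointwise ⟩
    sumFin (λ x → n ^ s + E * n ^ s * ind (popular x))
                                       ≡⟨ sum-+ {n} (λ _ → n ^ s) (λ x → E * n ^ s * ind (popular x)) ⟩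
    sumFin {n} (λ _ → n ^ s) + sumFin (λ x → E * n ^ s * ind (popular x))
                                       ≡⟨ cong₂ _+_ (sum-const n (n ^ s)) (sum-* (E * n ^ s) (ind ∘ popular)) ⟩
    n * n ^ s + E * n ^ s * pop        ≡⟨ cong (n * n ^ s +_) (comm₃ E (n ^ s) pop) ⟩
    n * n ^ s + E * pop * n ^ s        ∎))
    where
    comm₃ : ∀ a b c → a * b * c ≡ a * c * b
    comm₃ = solve-∀
  M≤pop : M ≤ pop
  M≤pop = *-cancelˡ-≤ E (≤-trans n≥ n≤pop)
  conclude : ∃ λ Z → Unique Z × length Z ≡ h ×
    n ^ s < suc (M * 2 ^ M) * sumL s (λ t → ind (all (λ z → P (z ∷ t)) Z))
  conclude with choose popular M M≤pop
  ... | Y , uY , lY , allPop = result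
    where
    good : List (Fin n) → List (Fin n) → Bool
    good t = all (λ z → P (z ∷ t))
    d : List (Fin n) → ℕ
    d t = sum (map (λ y → ind (P (y ∷ t))) Y)
    -- A tuple extended by fewer than h vertices of `Y` accounts for at most h, below the average h
    -- + 1; the richer tuples, at most M each, must carry the remaining `n ^ s`.
    d≤ : ∀ t → d t ≤ h + M * ind (someSublist (good t) h Y)
    d≤ t with h ≤? d t
    ... | yes p rewrite someSublist-filter (λ y → P (y ∷ t)) (good t) (λ Z → all⁺ (λ y → P (y ∷ t))) h Y p =
      ≤-trans (≤-trans (sum-ind≤length (λ y → P (y ∷ t)) Y) (≤-reflexive (trans lY (sym (*-identityʳ M)))))
              (m≤n+m _ h)
    ... | no ¬p = ≤-trans (<⇒≤ (≰⇒> ¬p)) (m≤m+n h _)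
    c : ℕ
    c = sumL s (λ t → ind (someSublist (good t) h Y))
    Mn≤ : E * (suc h * n ^ s) ≤ E * (h * n ^ s + M * c)
    Mn≤ = begin
      E * (suc h * n ^ s)                ≡⟨ trans (cong (_* n ^ s) M≡) (*-assoc E (suc h) (n ^ s)) ⟨
      M * n ^ s                          ≡⟨ cong (_* n ^ s) lY ⟨
      length Y * n ^ s                   ≤⟨ sum-map-lower f E (n ^ s) Y (All.map (⌊⌋⁻ (_ ≤? _)) allPop) ⟩
      E * sum (map f Y)                  ≡⟨ cong (E *_) (sum-map-sumL s (λ y t → ind (P (y ∷ t))) Y) ⟩
      E * sumL s d                       ≤⟨ *-monoʳ-≤ E (sumL-mono s λ t _ → d≤ t) ⟩
      E * sumL s (λ t → h + M * ind (someSublist (good t) h Y))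
        ≡⟨ cong (E *_) (sumL-+ {n} s (λ _ → h) (λ t → M * ind (someSublist (good t) h Y))) ⟩
      E * (sumL {n} s (λ _ → h) + sumL s (λ t → M * ind (someSublist (good t) h Y)))
        ≡⟨ cong (E *_) (cong₂ _+_ (trans (sumL-const {n} s h) (*-comm (n ^ s) h)) (sumL-* s M _)) ⟩
      E * (h * n ^ s + M * c)            ∎
    ns≤ : n ^ s ≤ M * c
    ns≤ = +-cancelˡ-≤ (h * n ^ s) _ _
      (≤-trans (≤-reflexive (+-comm (h * n ^ s) (n ^ s))) (*-cancelˡ-≤ E Mn≤))
    c>0 : 0 < c
    c>0 with c | ns≤
    ... | zero  | q = contradiction (≤-trans (m^n>0 n s) (≤-trans q (≤-reflexive (*-zeroʳ M)))) λ ()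
    ... | suc _ | _ = s≤s z≤n
    result : ∃ λ Z → Unique Z × length Z ≡ h ×
      n ^ s < suc (M * 2 ^ M) * sumL s (λ t → ind (all (λ z → P (z ∷ t)) Z))
    result with someSublist-pigeonhole s good h Y uY c>0
    ... | Z , _ , uZ , lZ , c≤ = Z , uZ , lZ , bound
      where
      c′ : ℕ
      c′ = sumL s (λ t → ind (good t Z))
      ns≤′ : n ^ s ≤ M * 2 ^ M * c′
      ns≤′ = ≤-trans ns≤ (≤-trans (*-monoʳ-≤ M (subst (λ l → c ≤ 2 ^ l * c′) lY c≤)) (≤-reflexive (sym (*-assoc M (2 ^ M) c′))))
      c′>0 : 0 < c′
      c′>0 with c′ | ns≤′
      ... | zero  | q = contradiction (≤-trans (m^n>0 n s) (≤-trans q (≤-reflexive (*-zeroʳ (M * 2 ^ M))))) λ ()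
      ... | suc _ | _ = s≤s z≤n
      -- `c′ > 0` pays for the strict inequality; hence the `suc` in the new constant.
      bound : n ^ s < suc (M * 2 ^ M) * c′
      bound = ≤-trans (s≤s ns≤′) (+-monoˡ-≤ _ c′>0)

box-cons : ∀ {n} (P : List (Fin n) → Bool) s h Z → Unique Z → length Z ≡ h →
  Box (λ t → all (λ z → P (z ∷ t)) Z) s h → Box P (suc s) h
box-cons {n} P s h Z uZ lZ (f , f-inj , holds) =
  F , F-inj , λ c → all⁻ (λ z → P (z ∷ tabulate (λ i → f i (c (suc i))))) (holds (λ i → c (suc i)))
                         (proj₂ (proj₂ g) (c zero))
  where
  g : Σ (Fin h → Fin n) λ g → Injective _≡_ _≡_ g × (∀ j → g j ∈ Z)
  g = enumerate Z uZ lZ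
  F : Fin (suc s) → Fin h → Fin n
  F zero    = proj₁ g
  F (suc i) = f i
  F-inj : ∀ i → Injective _≡_ _≡_ (F i)
  F-inj zero    = proj₁ (proj₂ g)
  F-inj (suc i) = f-inj i

box-extend : ∀ s h e E M → .{{_ : NonZero E}} → E ≡ 2 * e → M ≡ E * suc h → ∀ n₁ →
  (∀ n → n₁ ≤ n → (P : List (Fin n) → Bool) →
    n ^ s < suc (M * 2 ^ M) * sumL s (λ t → ind (P t)) → Box P s h) →
  ∀ n → suc (n₁ ⊔ E * M) ≤ n → (P : List (Fin n) → Bool) →
  n ^ suc s < e * sumL (suc s) (λ t → ind (P t)) → Box P (suc s) h
box-extend s h e E M E≡ M≡ n₁ IH n n≥ P dense = assemble (box-step P s h e E M E≡ M≡ n≥1 n≥EM dense)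
  where
  n≥1 : 1 ≤ n
  n≥1 = ≤-trans (s≤s z≤n) n≥
  n≥EM : E * M ≤ n
  n≥EM = ≤-trans (≤-trans (m≤n⊔m n₁ _) (n≤1+n _)) n≥
  n≥n₁ : n₁ ≤ n
  n≥n₁ = ≤-trans (≤-trans (m≤m⊔n n₁ _) (n≤1+n _)) n≥
  assemble : (∃ λ Z → Unique Z × length Z ≡ h ×
    n ^ s < suc (M * 2 ^ M) * sumL s (λ t → ind (all (λ z → P (z ∷ t)) Z))) → Box P (suc s) h
  assemble (Z , uZ , lZ , dense′) =
    box-cons P s h Z uZ lZ (IH n n≥n₁ (λ t → all (λ z → P (z ∷ t)) Z) dense′)

-- Erdős' box theorem.
box : ∀ s h e → ∃ λ n₀ → ∀ n → n₀ ≤ n → (P : List (Fin n) → Bool) →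
  n ^ s < e * sumL s (λ t → ind (P t)) → Box P s h
box zero h e = 0 , λ n _ P dense → (λ ()) , (λ ()) , λ c → holds n P dense
  where
  holds : ∀ n (P : List (Fin n) → Bool) → 1 < e * ind (P []) → P [] ≡ true
  holds n P dense with P []
  ... | true  = refl
  ... | false = contradiction (subst (1 <_) (*-zeroʳ e) dense) λ ()
box (suc s) h zero = 0 , λ n _ P ()
box (suc s) h (suc e) = suc (proj₁ IH ⊔ E * M) , box-extend s h (suc e) E M refl refl (proj₁ IH) (proj₂ IH)
  where
  E M : ℕ
  E = 2 * suc e
  M = E * suc h
  IH : ∃ λ n₀ → ∀ n → n₀ ≤ n → (P : List (Fin n) → Bool) →
    n ^ s < suc (M * 2 ^ M) * sumL s (λ t → ind (P t)) → Box P s h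
  IH = box s h (suc (M * 2 ^ M))

-- Rational arithmetic

toℚᵘ-ℕ→ℚ : ∀ n → toℚᵘ (ℕ→ℚ n) ℚᵘ.≃ mkℚᵘ (ℤ.+ n) 0
toℚᵘ-ℕ→ℚ n = ℚₚ.toℚᵘ-fromℚᵘ (mkℚᵘ (ℤ.+ n) 0)

ℕ→ℚ-+ : ∀ m n → ℕ→ℚ (m + n) ≡ ℕ→ℚ m ℚ.+ ℕ→ℚ n
ℕ→ℚ-+ m n = ℚₚ.toℚᵘ-injective (begin
  toℚᵘ (ℕ→ℚ (m + n))                     ≈⟨ toℚᵘ-ℕ→ℚ (m + n) ⟩
  mkℚᵘ (ℤ.+ (m + n)) 0                   ≈⟨ ℚᵘ.*≡* (cong (ℤ._* ℤ.+ 1) (sym (cong₂ ℤ._+_ (ℤₚ.*-identityʳ (ℤ.+ m)) (ℤₚ.*-identityʳ (ℤ.+ n))))) ⟩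
  mkℚᵘ (ℤ.+ m) 0 ℚᵘ.+ mkℚᵘ (ℤ.+ n) 0     ≈⟨ ℚᵘₚ.+-cong (toℚᵘ-ℕ→ℚ m) (toℚᵘ-ℕ→ℚ n) ⟨
  toℚᵘ (ℕ→ℚ m) ℚᵘ.+ toℚᵘ (ℕ→ℚ n)         ≈⟨ ℚₚ.toℚᵘ-homo-+ (ℕ→ℚ m) (ℕ→ℚ n) ⟨
  toℚᵘ (ℕ→ℚ m ℚ.+ ℕ→ℚ n)                 ∎)
  where open import Relation.Binary.Reasoning.Setoid ℚᵘₚ.≃-setoid

ℕ→ℚ-* : ∀ m n → ℕ→ℚ (m * n) ≡ ℕ→ℚ m ℚ.* ℕ→ℚ n
ℕ→ℚ-* m n = ℚₚ.toℚᵘ-injective (begin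
  toℚᵘ (ℕ→ℚ (m * n))                     ≈⟨ toℚᵘ-ℕ→ℚ (m * n) ⟩
  mkℚᵘ (ℤ.+ (m * n)) 0                   ≈⟨ ℚᵘ.*≡* (cong (ℤ._* ℤ.+ 1) (ℤₚ.pos-* m n)) ⟩
  mkℚᵘ (ℤ.+ m) 0 ℚᵘ.* mkℚᵘ (ℤ.+ n) 0     ≈⟨ ℚᵘₚ.*-cong (toℚᵘ-ℕ→ℚ m) (toℚᵘ-ℕ→ℚ n) ⟨
  toℚᵘ (ℕ→ℚ m) ℚᵘ.* toℚᵘ (ℕ→ℚ n)         ≈⟨ ℚₚ.toℚᵘ-homo-* (ℕ→ℚ m) (ℕ→ℚ n) ⟨
  toℚᵘ (ℕ→ℚ m ℚ.* ℕ→ℚ n)                 ∎)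
  where open import Relation.Binary.Reasoning.Setoid ℚᵘₚ.≃-setoid

ℕ→ℚ-mono-≤ : ∀ {m n} → m ≤ n → ℕ→ℚ m ℚ.≤ ℕ→ℚ n
ℕ→ℚ-mono-≤ {m} {n} m≤n = ℚₚ.toℚᵘ-cancel-≤
  (ℚᵘₚ.≤-respˡ-≃ (ℚᵘₚ.≃-sym (toℚᵘ-ℕ→ℚ m)) (ℚᵘₚ.≤-respʳ-≃ (ℚᵘₚ.≃-sym (toℚᵘ-ℕ→ℚ n))
    (ℚᵘ.*≤* (ℤₚ.*-monoʳ-≤-nonNeg (ℤ.+ 1) (ℤ.+≤+ m≤n)))))

ℕ→ℚ-cancel-≤ : ∀ {m n} → ℕ→ℚ m ℚ.≤ ℕ→ℚ n → m ≤ n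
ℕ→ℚ-cancel-≤ {m} {n} h
  with ℚᵘₚ.≤-respˡ-≃ (toℚᵘ-ℕ→ℚ m) (ℚᵘₚ.≤-respʳ-≃ (toℚᵘ-ℕ→ℚ n) (ℚₚ.toℚᵘ-mono-≤ h))
... | ℚᵘ.*≤* le = ℤₚ.drop‿+≤+ (subst₂ ℤ._≤_ (ℤₚ.*-identityʳ (ℤ.+ m)) (ℤₚ.*-identityʳ (ℤ.+ n)) le)

ℕ→ℚ-mono-< : ∀ {m n} → m < n → ℕ→ℚ m ℚ.< ℕ→ℚ n
ℕ→ℚ-mono-< {m} {n} m<n = ℚₚ.≰⇒> λ le → <⇒≱ m<n (ℕ→ℚ-cancel-≤ le)

ℕ→ℚ-positive : ∀ n → .{{NonZero n}} → ℚ.Positive (ℕ→ℚ n)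
ℕ→ℚ-positive n = ℚ.positive (ℕ→ℚ-mono-< {0} {n} (>-nonZero⁻¹ n))

ℕ→ℚ-nonNegative : ∀ n → ℚ.NonNegative (ℕ→ℚ n)
ℕ→ℚ-nonNegative n = ℚ.nonNegative (ℕ→ℚ-mono-≤ {0} {n} z≤n)

-- Evaluates `inv` without a separate proof of `x ≢ 0`, which the product already excludes.
inv-unique : ∀ x y → x ℚ.* y ≡ 1ℚ → inv x ≡ y
inv-unique x y xy with x ℚₚ.≟ 0ℚ
... | yes refl = contradiction (trans (sym (ℚₚ.*-zeroˡ y)) xy) λ ()
... | no x≢0 = begin
  1/x                ≡⟨ ℚₚ.*-identityʳ 1/x ⟨
  1/x ℚ.* 1ℚ         ≡⟨ cong (1/x ℚ.*_) xy ⟨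
  1/x ℚ.* (x ℚ.* y)  ≡⟨ ℚₚ.*-assoc 1/x x y ⟨
  1/x ℚ.* x ℚ.* y    ≡⟨ cong (ℚ._* y) (ℚₚ.*-inverseˡ x {{ℚ.≢-nonZero x≢0}}) ⟩
  1ℚ ℚ.* y           ≡⟨ ℚₚ.*-identityˡ y ⟩
  y                  ∎
  where
  open ≡-Reasoning
  1/x : ℚ
  1/x = (ℚ.1/ x) {{ℚ.≢-nonZero x≢0}}

*-inv : ∀ n → .{{NonZero n}} → ℕ→ℚ n ℚ.* inv (ℕ→ℚ n) ≡ 1ℚ
*-inv n with ℕ→ℚ n ℚₚ.≟ 0ℚ
... | yes e = contradiction (sym e) (ℚₚ.<⇒≢ (ℕ→ℚ-mono-< (>-nonZero⁻¹ n)))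
... | no ≢0 = ℚₚ.*-inverseʳ (ℕ→ℚ n) {{ℚ.≢-nonZero ≢0}}

-- The denominator of x serves as q, since multiplying by it leaves the positive numerator.
archimedes : ∀ x → 0ℚ ℚ.< x → ∃ λ q → NonZero q × 1ℚ ℚ.≤ ℕ→ℚ q ℚ.* x
archimedes x@(mkℚ ℤ.+[1+ k ] d _) _ = suc d , _ , ℚₚ.toℚᵘ-cancel-≤ (ℚᵘₚ.≤-respʳ-≃
  (ℚᵘₚ.≃-sym (ℚᵘₚ.≃-trans (ℚₚ.toℚᵘ-homo-* (ℕ→ℚ (suc d)) x) (ℚᵘₚ.*-congʳ {toℚᵘ x} (toℚᵘ-ℕ→ℚ (suc d)))))
  (ℚᵘ.*≤* (ℤ.+≤+ (≤-trans (≤-reflexive (trans (*-identityˡ _) (*-identityˡ (suc d))))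
                          (≤-trans (m≤m*n (suc d) (suc k)) (≤-reflexive (sym (*-identityʳ _))))))))
archimedes (mkℚ ℤ.+0 d _) (ℚ.*<* (ℤ.+<+ ()))
archimedes (mkℚ ℤ.-[1+ k ] d _) (ℚ.*<* ())

ℕ→ℚ-suc∸1 : ∀ r → ℕ→ℚ (suc r) ℚ.- 1ℚ ≡ ℕ→ℚ r
ℕ→ℚ-suc∸1 r = trans (cong (ℚ._- 1ℚ) (ℕ→ℚ-+ 1 r)) (cancel (ℕ→ℚ r))
  where
  open +-*-Solver
  cancel : ∀ a → (1ℚ ℚ.+ a) ℚ.- 1ℚ ≡ a
  cancel = solve 1 (λ a → (con 1ℚ :+ a) :- con 1ℚ := a) refl

-- Clears the nested fraction: 1/(r + 2/m) = m/(rm + 2).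
inv-lower : ∀ r m N → .{{NonZero m}} → .{{NonZero N}} → N ≡ r * m + 2 →
  inv (ℕ→ℚ r ℚ.+ ℕ→ℚ 2 ℚ.* inv (ℕ→ℚ m)) ≡ ℕ→ℚ m ℚ.* inv (ℕ→ℚ N)
inv-lower r m N N≡ = inv-unique (ℕ→ℚ r ℚ.+ ℕ→ℚ 2 ℚ.* inv (ℕ→ℚ m)) (ℕ→ℚ m ℚ.* inv (ℕ→ℚ N)) (begin
  (ℕ→ℚ r ℚ.+ ℕ→ℚ 2 ℚ.* inv (ℕ→ℚ m)) ℚ.* (ℕ→ℚ m ℚ.* inv (ℕ→ℚ N))
    ≡⟨ expand (ℕ→ℚ r) (ℕ→ℚ 2) (inv (ℕ→ℚ m)) (ℕ→ℚ m) (inv (ℕ→ℚ N)) ⟩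
  (ℕ→ℚ r ℚ.* ℕ→ℚ m ℚ.+ ℕ→ℚ 2 ℚ.* (ℕ→ℚ m ℚ.* inv (ℕ→ℚ m))) ℚ.* inv (ℕ→ℚ N)
    ≡⟨ cong (λ x → (ℕ→ℚ r ℚ.* ℕ→ℚ m ℚ.+ ℕ→ℚ 2 ℚ.* x) ℚ.* inv (ℕ→ℚ N)) (*-inv m) ⟩
  (ℕ→ℚ r ℚ.* ℕ→ℚ m ℚ.+ ℕ→ℚ 2 ℚ.* 1ℚ) ℚ.* inv (ℕ→ℚ N)
    ≡⟨ cong (ℚ._* inv (ℕ→ℚ N)) (cong₂ ℚ._+_ (sym (ℕ→ℚ-* r m)) (ℚₚ.*-identityʳ (ℕ→ℚ 2))) ⟩
  (ℕ→ℚ (r * m) ℚ.+ ℕ→ℚ 2) ℚ.* inv (ℕ→ℚ N)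
    ≡⟨ cong (ℚ._* inv (ℕ→ℚ N)) (trans (sym (ℕ→ℚ-+ (r * m) 2)) (cong ℕ→ℚ (sym N≡))) ⟩
  ℕ→ℚ N ℚ.* inv (ℕ→ℚ N)
    ≡⟨ *-inv N ⟩
  1ℚ ∎)
  where
  open ≡-Reasoning
  open +-*-Solver
  expand : ∀ r t im m iN → (r ℚ.+ t ℚ.* im) ℚ.* (m ℚ.* iN) ≡ (r ℚ.* m ℚ.+ t ℚ.* (m ℚ.* im)) ℚ.* iN
  expand = solve 5 (λ r t im m iN → (r :+ t :* im) :* (m :* iN) := (r :* m :+ t :* (m :* im)) :* iN) refl

lower-bound-strict : ∀ r m N → .{{NonZero r}} → .{{NonZero m}} → .{{NonZero N}} → N ≡ r * m + 2 →
  1ℚ ℚ.- inv (ℕ→ℚ r) ℚ.< 1ℚ ℚ.- ℕ→ℚ m ℚ.* inv (ℕ→ℚ N)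
lower-bound-strict r m N N≡ = ℚₚ.+-monoʳ-< 1ℚ (ℚₚ.neg-antimono-< {ℕ→ℚ m ℚ.* inv (ℕ→ℚ N)} {inv (ℕ→ℚ r)}
  (ℚₚ.*-cancelʳ-<-nonNeg (ℕ→ℚ (r * N)) {{ℕ→ℚ-nonNegative (r * N)}} {ℕ→ℚ m ℚ.* inv (ℕ→ℚ N)} {inv (ℕ→ℚ r)} (subst₂ ℚ._<_ (sym lhs) (sym rhs) (ℕ→ℚ-mono-< mr<N))))
  where
  open ≡-Reasoning
  open +-*-Solver
  mr<N : m * r < N
  mr<N = subst₂ _<_ (*-comm r m) (sym N≡) (m<m+n (r * m) (s≤s z≤n))
  lhs : ℕ→ℚ m ℚ.* inv (ℕ→ℚ N) ℚ.* ℕ→ℚ (r * N) ≡ ℕ→ℚ (m * r)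
  lhs = begin
    ℕ→ℚ m ℚ.* inv (ℕ→ℚ N) ℚ.* ℕ→ℚ (r * N)             ≡⟨ cong (ℕ→ℚ m ℚ.* inv (ℕ→ℚ N) ℚ.*_) (ℕ→ℚ-* r N) ⟩
    ℕ→ℚ m ℚ.* inv (ℕ→ℚ N) ℚ.* (ℕ→ℚ r ℚ.* ℕ→ℚ N)       ≡⟨ solve 4 (λ m i r N → m :* i :* (r :* N) := m :* r :* (N :* i)) refl (ℕ→ℚ m) (inv (ℕ→ℚ N)) (ℕ→ℚ r) (ℕ→ℚ N) ⟩
    ℕ→ℚ m ℚ.* ℕ→ℚ r ℚ.* (ℕ→ℚ N ℚ.* inv (ℕ→ℚ N))       ≡⟨ cong (ℕ→ℚ m ℚ.* ℕ→ℚ r ℚ.*_) (*-inv N) ⟩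
    ℕ→ℚ m ℚ.* ℕ→ℚ r ℚ.* 1ℚ                            ≡⟨ trans (ℚₚ.*-identityʳ _) (sym (ℕ→ℚ-* m r)) ⟩
    ℕ→ℚ (m * r)                                       ∎
  rhs : inv (ℕ→ℚ r) ℚ.* ℕ→ℚ (r * N) ≡ ℕ→ℚ N
  rhs = begin
    inv (ℕ→ℚ r) ℚ.* ℕ→ℚ (r * N)             ≡⟨ cong (inv (ℕ→ℚ r) ℚ.*_) (ℕ→ℚ-* r N) ⟩
    inv (ℕ→ℚ r) ℚ.* (ℕ→ℚ r ℚ.* ℕ→ℚ N)       ≡⟨ solve 3 (λ i r N → i :* (r :* N) := (r :* i) :* N) refl (inv (ℕ→ℚ r)) (ℕ→ℚ r) (ℕ→ℚ N) ⟩
    (ℕ→ℚ r ℚ.* inv (ℕ→ℚ r)) ℚ.* ℕ→ℚ N       ≡⟨ cong (ℚ._* ℕ→ℚ N) (*-inv r) ⟩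
    1ℚ ℚ.* ℕ→ℚ N                            ≡⟨ ℚₚ.*-identityˡ _ ⟩
    ℕ→ℚ N                                   ∎

-- Translates the degree condition for a blow-up on `T * N` vertices in which each vertex has at
-- most `T * m` non-neighbours.
degree-lower : ∀ c m N T d → .{{NonZero N}} → c ℚ.< 1ℚ ℚ.- ℕ→ℚ m ℚ.* inv (ℕ→ℚ N) →
  T * N ≤ d + T * m → c ℚ.* ℕ→ℚ (T * N) ℚ.≤ ℕ→ℚ d
degree-lower c m N T d c< h = begin
  c ℚ.* ℕ→ℚ (T * N)
    ≤⟨ ℚₚ.*-monoʳ-≤-nonNeg (ℕ→ℚ (T * N)) {{ℕ→ℚ-nonNegative (T * N)}} (ℚₚ.<⇒≤ c<) ⟩
  (1ℚ ℚ.- ℕ→ℚ m ℚ.* inv (ℕ→ℚ N)) ℚ.* ℕ→ℚ (T * N)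
    ≡⟨ cong ((1ℚ ℚ.- ℕ→ℚ m ℚ.* inv (ℕ→ℚ N)) ℚ.*_) (ℕ→ℚ-* T N) ⟩
  (1ℚ ℚ.- ℕ→ℚ m ℚ.* inv (ℕ→ℚ N)) ℚ.* (ℕ→ℚ T ℚ.* ℕ→ℚ N)
    ≡⟨ solve 4 (λ m i T N → (con 1ℚ :- m :* i) :* (T :* N) := T :* N :- T :* m :* (N :* i)) refl
         (ℕ→ℚ m) (inv (ℕ→ℚ N)) (ℕ→ℚ T) (ℕ→ℚ N) ⟩
  ℕ→ℚ T ℚ.* ℕ→ℚ N ℚ.- ℕ→ℚ T ℚ.* ℕ→ℚ m ℚ.* (ℕ→ℚ N ℚ.* inv (ℕ→ℚ N))
    ≡⟨ cong₂ ℚ._-_ (sym (ℕ→ℚ-* T N)) (trans (cong (ℕ→ℚ T ℚ.* ℕ→ℚ m ℚ.*_) (*-inv N)) (trans (ℚₚ.*-identityʳ _) (sym (ℕ→ℚ-* T m)))) ⟩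
  ℕ→ℚ (T * N) ℚ.- ℕ→ℚ (T * m)
    ≤⟨ ℚₚ.+-monoˡ-≤ (ℚ.- ℕ→ℚ (T * m)) (ℕ→ℚ-mono-≤ h) ⟩
  ℕ→ℚ (d + T * m) ℚ.- ℕ→ℚ (T * m)
    ≡⟨ trans (cong (ℚ._- ℕ→ℚ (T * m)) (ℕ→ℚ-+ d (T * m))) (solve 2 (λ d t → d :+ t :- t := d) refl (ℕ→ℚ d) (ℕ→ℚ (T * m))) ⟩
  ℕ→ℚ d ∎
  where
  open ℚₚ.≤-Reasoning
  open +-*-Solver

inv-upper : ∀ r ρ → .{{NonZero ρ}} → ρ ≡ 3 * r + 5 →
  inv (ℕ→ℚ (2 + r) ℚ.- inv (ℕ→ℚ 3)) ≡ ℕ→ℚ 3 ℚ.* inv (ℕ→ℚ ρ)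
inv-upper r ρ ρ≡ = inv-unique (ℕ→ℚ (2 + r) ℚ.- inv (ℕ→ℚ 3)) (ℕ→ℚ 3 ℚ.* inv (ℕ→ℚ ρ)) (begin
  (ℕ→ℚ (2 + r) ℚ.- inv (ℕ→ℚ 3)) ℚ.* (ℕ→ℚ 3 ℚ.* inv (ℕ→ℚ ρ))
    ≡⟨ solve 4 (λ s i t k → (s :- i) :* (t :* k) := (t :* s :- t :* i) :* k) refl (ℕ→ℚ (2 + r)) (inv (ℕ→ℚ 3)) (ℕ→ℚ 3) (inv (ℕ→ℚ ρ)) ⟩
  (ℕ→ℚ 3 ℚ.* ℕ→ℚ (2 + r) ℚ.- ℕ→ℚ 3 ℚ.* inv (ℕ→ℚ 3)) ℚ.* inv (ℕ→ℚ ρ)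
    ≡⟨ cong (ℚ._* inv (ℕ→ℚ ρ)) (cong₂ ℚ._-_ (trans (sym (ℕ→ℚ-* 3 (2 + r))) (cong ℕ→ℚ 3r)) (*-inv 3)) ⟩
  (ℕ→ℚ (suc ρ) ℚ.- 1ℚ) ℚ.* inv (ℕ→ℚ ρ)
    ≡⟨ cong (ℚ._* inv (ℕ→ℚ ρ)) (ℕ→ℚ-suc∸1 ρ) ⟩
  ℕ→ℚ ρ ℚ.* inv (ℕ→ℚ ρ)
    ≡⟨ *-inv ρ ⟩
  1ℚ ∎)
  where
  open ≡-Reasoning
  open +-*-Solver
  expand : ∀ r → 3 * (2 + r) ≡ suc (3 * r + 5)
  expand = solve-∀
  3r : 3 * (2 + r) ≡ suc ρ
  3r = trans (expand r) (cong suc (sym ρ≡))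

-- With d neighbours, m non-neighbours and n = d + m, the conclusion says that m is at most (3 -
-- 1/q) n / ρ. The integer q measures how far c exceeds the threshold.
degree-upper : ∀ c ρ → .{{NonZero ρ}} → 1ℚ ℚ.- ℕ→ℚ 3 ℚ.* inv (ℕ→ℚ ρ) ℚ.< c →
  ∃ λ q → NonZero q × (∀ d m → c ℚ.* ℕ→ℚ (d + m) ℚ.≤ ℕ→ℚ d → q * ρ * m + (d + m) ≤ 3 * q * (d + m))
degree-upper c ρ U<c =
  let q , q≢0 , 1≤ = archimedes gap gap>0 in q , q≢0 , λ d m h → ℕ→ℚ-cancel-≤ (bound q 1≤ d m h)
  where
  open ℚₚ.≤-Reasoning
  open +-*-Solver
  R = ℕ→ℚ ρ
  gap : ℚ
  gap = R ℚ.* (c ℚ.- (1ℚ ℚ.- ℕ→ℚ 3 ℚ.* inv R))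
  gap>0 : 0ℚ ℚ.< gap
  gap>0 = subst (ℚ._< gap) (ℚₚ.*-zeroʳ R) (ℚₚ.*-monoʳ-<-pos R {{ℕ→ℚ-positive ρ}}
    (subst (ℚ._< c ℚ.- (1ℚ ℚ.- ℕ→ℚ 3 ℚ.* inv R)) (ℚₚ.+-inverseʳ (1ℚ ℚ.- ℕ→ℚ 3 ℚ.* inv R))
      (ℚₚ.+-monoˡ-< (ℚ.- (1ℚ ℚ.- ℕ→ℚ 3 ℚ.* inv R)) U<c)))
  bound : ∀ q → 1ℚ ℚ.≤ ℕ→ℚ q ℚ.* gap → ∀ d m → c ℚ.* ℕ→ℚ (d + m) ℚ.≤ ℕ→ℚ d →
    ℕ→ℚ (q * ρ * m + (d + m)) ℚ.≤ ℕ→ℚ (3 * q * (d + m))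
  bound q 1≤ d m h = begin
    ℕ→ℚ (q * ρ * m + (d + m))
      ≡⟨ trans (ℕ→ℚ-+ (q * ρ * m) (d + m)) (cong₂ ℚ._+_ (trans (ℕ→ℚ-* (q * ρ) m) (cong (ℚ._* ℕ→ℚ m) (ℕ→ℚ-* q ρ)))
           (sym (ℚₚ.*-identityˡ _))) ⟩
    Q ℚ.* R ℚ.* ℕ→ℚ m ℚ.+ 1ℚ ℚ.* n
      ≤⟨ ℚₚ.+-mono-≤ (ℚₚ.*-monoˡ-≤-nonNeg (Q ℚ.* R) {{subst ℚ.NonNegative (ℕ→ℚ-* q ρ) (ℕ→ℚ-nonNegative (q * ρ))}} m≤)
                     (ℚₚ.*-monoʳ-≤-nonNeg n {{ℕ→ℚ-nonNegative (d + m)}} 1≤) ⟩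
    Q ℚ.* R ℚ.* (n ℚ.- c ℚ.* n) ℚ.+ Q ℚ.* gap ℚ.* n
      ≡⟨ solve 6 (λ Q R n c t i → Q :* R :* (n :- c :* n) :+ Q :* (R :* (c :- (con 1ℚ :- t :* i))) :* n
            := t :* Q :* n :* (R :* i)) refl Q R n c (ℕ→ℚ 3) (inv R) ⟩
    ℕ→ℚ 3 ℚ.* Q ℚ.* n ℚ.* (R ℚ.* inv R)
      ≡⟨ trans (cong (ℕ→ℚ 3 ℚ.* Q ℚ.* n ℚ.*_) (*-inv ρ)) (ℚₚ.*-identityʳ _) ⟩
    ℕ→ℚ 3 ℚ.* Q ℚ.* n
      ≡⟨ trans (ℕ→ℚ-* (3 * q) (d + m)) (cong (ℚ._* n) (ℕ→ℚ-* 3 q)) ⟨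
    ℕ→ℚ (3 * q * (d + m)) ∎
    where
    n = ℕ→ℚ (d + m)
    Q = ℕ→ℚ q
    m≤ : ℕ→ℚ m ℚ.≤ n ℚ.- c ℚ.* n
    m≤ = begin
      ℕ→ℚ m             ≡⟨ solve 2 (λ d m → m := d :+ m :- d) refl (ℕ→ℚ d) (ℕ→ℚ m) ⟩
      ℕ→ℚ d ℚ.+ ℕ→ℚ m ℚ.- ℕ→ℚ d ≡⟨ cong (ℚ._- ℕ→ℚ d) (ℕ→ℚ-+ d m) ⟨
      n ℚ.- ℕ→ℚ d       ≤⟨ ℚₚ.+-monoʳ-≤ n (ℚₚ.neg-antimono-≤ h) ⟩
      n ℚ.- c ℚ.* n     ∎

η-upper : ∀ η e k n → 1ℚ ℚ.≤ ℕ→ℚ e ℚ.* η → 0ℚ ℚ.< η → e * k ≤ n * n → ℕ→ℚ k ℚ.≤ η ℚ.* (ℕ→ℚ n ℚ.* ℕ→ℚ n)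
η-upper η e k n 1≤ η>0 h = begin
  ℕ→ℚ k                        ≡⟨ ℚₚ.*-identityˡ _ ⟨
  1ℚ ℚ.* ℕ→ℚ k                 ≤⟨ ℚₚ.*-monoʳ-≤-nonNeg (ℕ→ℚ k) {{ℕ→ℚ-nonNegative k}} 1≤ ⟩
  ℕ→ℚ e ℚ.* η ℚ.* ℕ→ℚ k        ≡⟨ solve 3 (λ e η k → e :* η :* k := η :* (e :* k)) refl (ℕ→ℚ e) η (ℕ→ℚ k) ⟩
  η ℚ.* (ℕ→ℚ e ℚ.* ℕ→ℚ k)      ≡⟨ cong (η ℚ.*_) (ℕ→ℚ-* e k) ⟨
  η ℚ.* ℕ→ℚ (e * k)            ≤⟨ ℚₚ.*-monoˡ-≤-nonNeg η {{ℚ.nonNegative (ℚₚ.<⇒≤ η>0)}} (ℕ→ℚ-mono-≤ h) ⟩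
  η ℚ.* ℕ→ℚ (n * n)            ≡⟨ cong (η ℚ.*_) (ℕ→ℚ-* n n) ⟩
  η ℚ.* (ℕ→ℚ n ℚ.* ℕ→ℚ n)      ∎
  where
  open ℚₚ.≤-Reasoning
  open +-*-Solver

η-lower : ∀ k d n → .{{NonZero k}} → ℕ→ℚ d ℚ.≤ inv (ℕ→ℚ k) ℚ.* (ℕ→ℚ n ℚ.* ℕ→ℚ n) → k * d ≤ n * n
η-lower k d n h = ℕ→ℚ-cancel-≤ (begin
  ℕ→ℚ (k * d)                                        ≡⟨ ℕ→ℚ-* k d ⟩
  ℕ→ℚ k ℚ.* ℕ→ℚ d                                    ≤⟨ ℚₚ.*-monoˡ-≤-nonNeg (ℕ→ℚ k) {{ℕ→ℚ-nonNegative k}} h ⟩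
  ℕ→ℚ k ℚ.* (inv (ℕ→ℚ k) ℚ.* (ℕ→ℚ n ℚ.* ℕ→ℚ n))      ≡⟨ ℚₚ.*-assoc (ℕ→ℚ k) (inv (ℕ→ℚ k)) _ ⟨
  ℕ→ℚ k ℚ.* inv (ℕ→ℚ k) ℚ.* (ℕ→ℚ n ℚ.* ℕ→ℚ n)        ≡⟨ cong₂ ℚ._*_ (*-inv k) (sym (ℕ→ℚ-* n n)) ⟩
  1ℚ ℚ.* ℕ→ℚ (n * n)                                 ≡⟨ ℚₚ.*-identityˡ _ ⟩
  ℕ→ℚ (n * n)                                        ∎)
  where open ℚₚ.≤-Reasoning

inv-positive : ∀ k → .{{NonZero k}} → 0ℚ ℚ.< inv (ℕ→ℚ k)
inv-positive k = ℚₚ.*-cancelˡ-<-nonNeg (ℕ→ℚ k) {{ℕ→ℚ-nonNegative k}}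
  (subst₂ ℚ._<_ (sym (ℚₚ.*-zeroʳ (ℕ→ℚ k))) (sym (*-inv k)) (ℕ→ℚ-mono-< {0} {1} (s≤s z≤n)))

-- Cliques in dense graphs

module Cliques (G : Graph) (simple : IsSimple G) where

  V : Set
  V = Fin (size G)

  infix 4 _~_ _~?_

  _~_ : V → V → Set
  u ~ v = adj G u v ≡ true

  _~?_ : ∀ u v → Dec (u ~ v)
  u ~? v = adj G u v Bool.≟ true

  ~-sym : ∀ {u v} → u ~ v → v ~ u
  ~-sym {u} {v} e = trans (proj₁ simple v u) e

  ~-irrefl : ∀ {u} → ¬ u ~ u
  ~-irrefl {u} e with trans (sym e) (proj₂ simple u)
  ... | ()

  Clique : List V → Set
  Clique = AllPairs _~_

  isK : List V → Bool
  isK t = ⌊ allPairs? _~?_ t ⌋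

  hasK : ℕ → List V → Bool
  hasK = someSublist isK

  length-filter-~ : ∀ w {Q} → Clique Q → w ∈ Q → length Q ≡ suc (length (filter (w ~?_) Q))
  length-filter-~ w {u ∷ Q} (u~ ∷ cQ) (here refl) with w ~? w
  ... | yes e = contradiction e ~-irrefl
  ... | no  _ = cong (suc ∘ length) (sym (filter-all (w ~?_) u~))
  length-filter-~ w {u ∷ Q} (u~ ∷ cQ) (there w∈) with w ~? u
  ... | yes _ = cong suc (length-filter-~ w cQ w∈)
  ... | no ¬e = contradiction (~-sym (All.lookup u~ w∈)) ¬e

  drop-head : ∀ {u w : V} {t} → u ≢ w → u ∈ w ∷ t → u ∈ t
  drop-head u≢w (here e)   = contradiction e u≢w
  drop-head u≢w (there u∈) = u∈

  -- The entries of `Q` may come in another order than in t, and may be repeated there, so the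
  -- sublist is rebuilt along t. `S` collects adjacency to the entries already chosen, matching what
  -- has been absorbed into `P`; filtering by it removes exactly w from a clique containing w.
  someSublist-clique : ∀ (P : List V → Bool) (S : V → Set) →
    (∀ Q → Clique Q → All S Q → P Q ≡ true) →
    ∀ s t Q → length Q ≡ s → Clique Q → All S Q → Q ⊆ t → someSublist P s t ≡ true
  someSublist-clique P S h zero    t       Q       l cQ sQ Q⊆ = h [] [] []
  someSublist-clique P S h (suc s) []      (u ∷ Q) l cQ sQ Q⊆ with Q⊆ (here refl)
  ... | ()
  someSublist-clique P S h (suc s) (w ∷ t) Q       l cQ sQ Q⊆ with DecMembership._∈?_ Fin._≟_ w Q
  ... | yes w∈ = ∨⁺ˡ (someSublist-clique (P ∘ (w ∷_)) (λ u → S u × w ~ u)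
                   (λ Q′ c a → h (w ∷ Q′) (All.map proj₂ a ∷ c) (All.lookup sQ w∈ ∷ All.map proj₁ a))
                   s t (filter (w ~?_) Q) (suc-injective (trans (sym (length-filter-~ w cQ w∈)) l))
                   (AllPairsₚ.filter⁺ (w ~?_) cQ)
                   (All.zip (Allₚ.filter⁺ (w ~?_) sQ , Allₚ.all-filter (w ~?_) Q))
                   (λ q → let u∈ , w~u = ∈-filter⁻ (w ~?_) {xs = Q} q in
                          drop-head (λ { refl → ~-irrefl w~u }) (Q⊆ u∈)))
  ... | no  w∉ = ∨⁺ʳ (someSublist (P ∘ (w ∷_)) s t)
                   (someSublist-clique P S h (suc s) t Q l cQ sQ (λ q → drop-head (λ { refl → w∉ q }) (Q⊆ q)))

  hasK⁺ : ∀ {s t} Q → length Q ≡ s → Clique Q → Q ⊆ t → hasK s t ≡ true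
  hasK⁺ {s} {t} Q l cQ Q⊆ =
    someSublist-clique isK (λ u → u ≡ u) (λ Q′ c _ → ⌊⌋⁺ (allPairs? _~?_ Q′) c) s t Q l cQ (All.tabulate λ _ → refl) Q⊆

  hasK⁻ : ∀ {s t} → hasK s t ≡ true → ∃ λ Q → length Q ≡ s × Clique Q × Q ⊆ t
  hasK⁻ {s} {t} h = let Q , l , k , i = someSublist-sound isK s t h in Q , l , ⌊⌋⁻ (allPairs? _~?_ Q) k , i

  Monotone : (List V → Bool) → Set
  Monotone P = ∀ {t t′} → t ⊆ t′ → P t ≡ true → P t′ ≡ true

  hasK-mono : ∀ s → Monotone (hasK s)
  hasK-mono s t⊆ h = let Q , l , c , i = hasK⁻ {s} h in hasK⁺ Q l c (t⊆ ∘ i)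

  -- Nested "for a proportion at least 1 / c of all vertices w".
  Rob : ℕ → ℕ → (List V → Bool) → List V → Bool
  Rob c zero    P t = P t
  Rob c (suc j) P t = ⌊ size G ≤? c * sumFin (λ w → ind (Rob c j P (w ∷ t))) ⌋

  module _ (c : ℕ) where

    -- Double counting: every quantifier supplies at least n/c choices of w, so each tuple has at
    -- least `(n / c) ^ j` extensions satisfying `P`.
    Rob-count : ∀ j a P → size G ^ j * sumL a (λ t → ind (Rob c j P t)) ≤ c ^ j * sumL (j + a) (λ t → ind (P t))
    Rob-count zero    a P = ≤-refl
    Rob-count (suc j) a P = begin
      n * n ^ j * sumL a (λ t → ind (Rob c (suc j) P t))
        ≡⟨ trans (cong (_* sumL a (λ t → ind (Rob c (suc j) P t))) (*-comm n (n ^ j))) (*-assoc (n ^ j) n _) ⟩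
      n ^ j * (n * sumL a (λ t → ind (Rob c (suc j) P t)))
        ≡⟨ cong (n ^ j *_) (sumL-* a n _) ⟨
      n ^ j * sumL a (λ t → n * ind (Rob c (suc j) P t))
        ≤⟨ *-monoʳ-≤ (n ^ j) (sumL-mono a λ t _ → pointwise t) ⟩
      n ^ j * sumL a (λ t → c * sumFin (λ w → ind (Rob c j P (w ∷ t))))
        ≡⟨ cong (n ^ j *_) (trans (sumL-* a c _) (cong (c *_) (sumL-swap a (λ w t → ind (Rob c j P (w ∷ t)))))) ⟩
      n ^ j * (c * S)
        ≡⟨ trans (sym (*-assoc (n ^ j) c S)) (trans (cong (_* S) (*-comm (n ^ j) c)) (*-assoc c (n ^ j) S)) ⟩
      c * (n ^ j * S)
        ≤⟨ *-monoʳ-≤ c (Rob-count j (suc a) P) ⟩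
      c * (c ^ j * sumL (j + suc a) (λ t → ind (P t)))
        ≡⟨ trans (sym (*-assoc c (c ^ j) _)) (cong (λ m → c ^ suc j * sumL m (λ t → ind (P t))) (+-suc j a)) ⟩
      c ^ suc j * sumL (suc j + a) (λ t → ind (P t)) ∎
      where
      open ≤-Reasoning
      n S : ℕ
      n = size G
      S = sumL (suc a) (λ t → ind (Rob c j P t))
      pointwise : ∀ t → n * ind (Rob c (suc j) P t) ≤ c * sumFin (λ w → ind (Rob c j P (w ∷ t)))
      pointwise t with n ≤? c * sumFin (λ w → ind (Rob c j P (w ∷ t)))
      ... | yes p = ≤-trans (≤-reflexive (*-identityʳ n)) p
      ... | no  _ = ≤-trans (≤-reflexive (*-zeroʳ n)) z≤n

    -- Sequential composition: the second argument may depend on the vertices found by the first,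
    -- which are recorded in `t′`.
    Rob-bind : ∀ j j′ {P P′ : List V → Bool} t →
      (∀ {t′} → t ⊆ t′ → P t′ ≡ true → Rob c j′ P′ t′ ≡ true) →
      Rob c j P t ≡ true → Rob c (j + j′) P′ t ≡ true
    Rob-bind zero    j′ t f h = f id h
    Rob-bind (suc j) j′ {P} t f h = ⌊⌋⁺ (_ ≤? _) (≤-trans (⌊⌋⁻ (_ ≤? _) h)
      (*-monoʳ-≤ c (sum-mono λ w → ind-mono (Rob-bind j j′ {P} (w ∷ t) (λ i → f (i ∘ there))))))

    Rob-⊆ : ∀ j {P} → Monotone P → Monotone (Rob c j P)
    Rob-⊆ zero    mono i h = mono i h
    Rob-⊆ (suc j) mono {t} {t′} i h = ⌊⌋⁺ (_ ≤? _) (≤-trans (⌊⌋⁻ (_ ≤? _) h)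
      (*-monoʳ-≤ c (sum-mono {size G} λ w → ind-mono (Rob-⊆ j mono {w ∷ t} {w ∷ t′} (∷⁺ʳ w i)))))

    -- An argument that ends early can be padded with idle steps, since a monotone property survives
    -- any additional vertex.
    Rob-weaken : .{{NonZero c}} → ∀ j {P} → Monotone P → ∀ t → P t ≡ true → Rob c j P t ≡ true
    Rob-weaken zero    mono t h = h
    Rob-weaken (suc j) {P} mono t h = ⌊⌋⁺ (_ ≤? _) (begin
      n                                        ≡⟨ trans (sum-const n 1) (*-identityʳ n) ⟨
      sumFin {n} (λ _ → 1)                     ≤⟨ sum-mono all-good ⟩
      sumFin (λ w → ind (Rob c j P (w ∷ t)))   ≤⟨ m≤n*m _ c ⟩
      c * sumFin (λ w → ind (Rob c j P (w ∷ t))) ∎)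
      where
      open ≤-Reasoning
      n : ℕ
      n = size G
      all-good : ∀ w → 1 ≤ ind (Rob c j P (w ∷ t))
      all-good w rewrite Rob-weaken j {P} mono (w ∷ t) (mono there h) = ≤-refl

-- Arithmetic of the local extension arguments

private
  low : ∀ v x y a b c {v′ x′ y′ a′ b′ c′} → v′ ≤ v → x′ ≤ x → y′ ≤ y → a′ ≤ a → b′ ≤ b → c′ ≤ c →
    v′ + (x′ + (y′ + (a′ + (b′ + (c′ + (c′ + c′)))))) ≤ v + (x + (y + (a + (b + (c + (c + c))))))
  low _ _ _ _ _ _ p q r s t u =
    +-mono-≤ p (+-mono-≤ q (+-mono-≤ r (+-mono-≤ s (+-mono-≤ t (+-mono-≤ u (+-mono-≤ u u))))))

  1≤ : ∀ {m} → 1 ≤ suc m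
  1≤ = s≤s z≤n

  2≤ : ∀ {m} → 2 ≤ suc (suc m)
  2≤ = s≤s 1≤

-- The variables count the non-neighbours of a vertex w among v, x, y and in `A`, `B`, `S`. A miss
-- in `S` alone has weight 3. Otherwise the hypotheses say that w misses something in each of v + A,
-- x + A, v + B, y + B, and exclude that it misses just one vertex of `A` and one of `B`; the cases
-- are those of total weight at most 2.
wheel-misses≥3 : ∀ v x y a b c →
  (c ≡ 0 → 0 < v + a) → (c ≡ 0 → 0 < x + a) → (c ≡ 0 → 0 < v + b) → (c ≡ 0 → 0 < y + b) →
  (v ≡ 0 → x ≡ 0 → y ≡ 0 → a ≡ 1 → b ≡ 1 → c ≡ 0 → ⊥) →
  3 ≤ v + (x + (y + (a + (b + (c + (c + c))))))
wheel-misses≥3 v x y a b (suc c)                                     _ _ _ _ _ = low v x y a b (suc c) z≤n z≤n z≤n z≤n z≤n 1≤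
wheel-misses≥3 zero x y zero b zero                                  h _ _ _ _ = contradiction (h refl) λ ()
wheel-misses≥3 (suc v) zero y zero b zero                            _ h _ _ _ = contradiction (h refl) λ ()
wheel-misses≥3 (suc v) (suc x) zero zero zero zero                   _ _ _ h _ = contradiction (h refl) λ ()
wheel-misses≥3 (suc v) (suc x) (suc y) zero zero zero                _ _ _ _ _ = low (suc v) (suc x) (suc y) zero zero zero 1≤ 1≤ 1≤ z≤n z≤n z≤n
wheel-misses≥3 (suc v) (suc x) y zero (suc b) zero                   _ _ _ _ _ = low (suc v) (suc x) y zero (suc b) zero 1≤ 1≤ z≤n z≤n 1≤ z≤n
wheel-misses≥3 zero x y (suc a) zero zero                            _ _ h _ _ = contradiction (h refl) λ ()
wheel-misses≥3 (suc v) x zero (suc a) zero zero                      _ _ _ h _ = contradiction (h refl) λ ()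
wheel-misses≥3 (suc v) x (suc y) (suc a) zero zero                   _ _ _ _ _ = low (suc v) x (suc y) (suc a) zero zero 1≤ z≤n 1≤ 1≤ z≤n z≤n
wheel-misses≥3 v x y (suc (suc a)) (suc b) zero                      _ _ _ _ _ = low v x y (suc (suc a)) (suc b) zero z≤n z≤n z≤n 2≤ 1≤ z≤n
wheel-misses≥3 v x y (suc zero) (suc (suc b)) zero                   _ _ _ _ _ = low v x y (suc zero) (suc (suc b)) zero z≤n z≤n z≤n 1≤ 2≤ z≤n
wheel-misses≥3 (suc v) x y (suc zero) (suc zero) zero                _ _ _ _ _ = low (suc v) x y (suc zero) (suc zero) zero 1≤ z≤n z≤n 1≤ 1≤ z≤n
wheel-misses≥3 zero (suc x) y (suc zero) (suc zero) zero             _ _ _ _ _ = low zero (suc x) y (suc zero) (suc zero) zero z≤n 1≤ z≤n 1≤ 1≤ z≤n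
wheel-misses≥3 zero zero (suc y) (suc zero) (suc zero) zero          _ _ _ _ _ = low zero zero (suc y) (suc zero) (suc zero) zero z≤n z≤n 1≤ 1≤ 1≤ z≤n
wheel-misses≥3 zero zero zero (suc zero) (suc zero) zero             _ _ _ _ h = ⊥-elim (h refl refl refl refl refl refl)

swap-misses≥2 : ∀ x i j → (i ≡ 0 → j ≡ 0 → ⊥) → (x ≡ 0 → i ≡ 1 → j ≡ 0 → ⊥) → 2 ≤ x + (i + (j + j))
swap-misses≥2 x i (suc j) _ _ =
  ≤-trans (+-mono-≤ (s≤s (z≤n {j})) (s≤s (z≤n {j}))) (≤-trans (m≤n+m _ i) (m≤n+m _ x))
swap-misses≥2 x zero zero h _ = ⊥-elim (h refl refl)
swap-misses≥2 (suc x) (suc i) zero _ _ = s≤s (≤-trans (s≤s z≤n) (m≤n+m _ x))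
swap-misses≥2 zero (suc zero) zero _ h = ⊥-elim (h refl refl refl)
swap-misses≥2 zero (suc (suc i)) zero _ _ = s≤s (s≤s z≤n)

-- `S` is the total weight missed on a list of length l. The term `l * n` in the second hypothesis
-- is the slack; `3 * l ≤ τ * ρ` makes the main terms cancel and leaves the slack as a lower bound
-- for the number g of good vertices.
ext-arith : ∀ n q ρ τ l S g → τ * n ≤ S + τ * g → q * ρ * S + l * n ≤ l * (3 * q * n) → 3 * l ≤ τ * ρ →
  l * n ≤ τ * ρ * q * g
ext-arith n q ρ τ l S g h₁ h₂ h₃ = +-cancelˡ-≤ (τ * ρ * (q * n)) _ _ (begin
  τ * ρ * (q * n) + l * n             ≡⟨ cong (_+ l * n) (e₁ n q ρ τ) ⟩
  q * ρ * (τ * n) + l * n             ≤⟨ +-monoˡ-≤ (l * n) (*-monoʳ-≤ (q * ρ) h₁) ⟩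
  q * ρ * (S + τ * g) + l * n         ≡⟨ e₂ q ρ S τ g (l * n) ⟩
  (q * ρ * S + l * n) + τ * ρ * q * g ≤⟨ +-monoˡ-≤ _ h₂ ⟩
  l * (3 * q * n) + τ * ρ * q * g     ≡⟨ cong (_+ τ * ρ * q * g) (e₃ l q n) ⟩
  3 * l * (q * n) + τ * ρ * q * g     ≤⟨ +-monoˡ-≤ _ (*-monoˡ-≤ (q * n) h₃) ⟩
  τ * ρ * (q * n) + τ * ρ * q * g     ∎)
  where
  open ≤-Reasoning
  e₁ : ∀ n q ρ τ → τ * ρ * (q * n) ≡ q * ρ * (τ * n)
  e₁ = solve-∀
  e₂ : ∀ q ρ S τ g m → q * ρ * (S + τ * g) + m ≡ (q * ρ * S + m) + τ * ρ * q * g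
  e₂ = solve-∀
  e₃ : ∀ l q n → l * (3 * q * n) ≡ 3 * l * (q * n)
  e₃ = solve-∀

-- Three ratio estimates chained without division: `F` counts forced tuples, h the N-tuples that
-- contain a large clique, κs the large cliques and κ the cliques one vertex smaller; a, b, m are
-- powers of n, and `X`, `Y` collect the constants lost.
average-arith : ∀ e X Y a b n² m F h κs κ → .{{NonZero X}} → .{{NonZero Y}} → .{{NonZero a}} → .{{NonZero b}} →
  ∀ cJ twoN → X ≡ cJ * twoN →
  m ≤ Y * κ → b * F ≤ cJ * h → a * h ≤ twoN * (b * (n² * m) * κs) → e * Y * X * κs ≤ a → e * F ≤ n² * κ
average-arith e X Y a b n² m F h κs κ cJ twoN X≡ h₁ h₂ h₃ h₄ =
  *-cancelˡ-≤ Y (*-cancelˡ-≤ b (*-cancelˡ-≤ X (*-cancelˡ-≤ a (begin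
    a * (X * (b * (Y * (e * F))))                ≡⟨ e₁ a X b Y e F ⟩
    e * Y * X * (a * (b * F))                    ≤⟨ *-monoʳ-≤ (e * Y * X) (*-monoʳ-≤ a h₂) ⟩
    e * Y * X * (a * (cJ * h))                   ≡⟨ e₂ (e * Y * X) a cJ h ⟩
    e * Y * X * cJ * (a * h)                     ≤⟨ *-monoʳ-≤ (e * Y * X * cJ) h₃ ⟩
    e * Y * X * cJ * (twoN * (b * (n² * m) * κs)) ≡⟨ e₃ (e * Y * X) cJ twoN b n² m κs ⟩
    cJ * twoN * (b * (n² * m)) * (e * Y * X * κs) ≤⟨ *-monoʳ-≤ (cJ * twoN * (b * (n² * m))) h₄ ⟩
    cJ * twoN * (b * (n² * m)) * a               ≡⟨ cong (λ x → x * (b * (n² * m)) * a) X≡ ⟨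
    X * (b * (n² * m)) * a                       ≤⟨ *-monoˡ-≤ a (*-monoʳ-≤ X (*-monoʳ-≤ b (*-monoʳ-≤ n² h₁))) ⟩
    X * (b * (n² * (Y * κ))) * a                 ≡⟨ e₄ X b n² Y κ a ⟩
    a * (X * (b * (Y * (n² * κ))))               ∎))))
  where
  open ≤-Reasoning
  e₁ : ∀ a X b Y e F → a * (X * (b * (Y * (e * F)))) ≡ e * Y * X * (a * (b * F))
  e₁ = solve-∀
  e₂ : ∀ E a c h → E * (a * (c * h)) ≡ E * c * (a * h)
  e₂ = solve-∀
  e₃ : ∀ E c t b n m k → E * c * (t * (b * (n * m) * k)) ≡ c * t * (b * (n * m)) * (E * k)
  e₃ = solve-∀
  e₄ : ∀ X b n Y k a → X * (b * (n * (Y * k))) * a ≡ a * (X * (b * (Y * (n * k))))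
  e₄ = solve-∀

-- The graph is to be split into R = r + 2 parts; ρ = 3R − 1, and `few` says that every vertex has
-- at most (3 − 1/q) n / ρ non-neighbours. The constant c bounds the loss in all "positive proportion" steps.
module Dense (G : Graph) (simple : IsSimple G) (r q ρ c : ℕ) (ρ≡ : ρ ≡ 3 * r + 5)
  (c≡ : c ≡ (2 + r) * (3 * ρ * q)) {{c≢0 : NonZero c}}
  (few : ∀ v → q * ρ * sumFin (λ w → ind (not (adj G v w))) + size G ≤ 3 * q * size G) where

  open Cliques G simple

  n : ℕ
  n = size G

  miss : V → V → ℕ
  miss u w = ind (not (adj G u w))

  -- Entries count with multiplicity, so repeating a block of the list gives its vertices more
  -- weight.
  missL : List V → V → ℕ
  missL L w = sum (map (λ u → miss u w) L)

  missL-++ : ∀ X Y w → missL (X ++ Y) w ≡ missL X w + missL Y w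
  missL-++ []      Y w = refl
  missL-++ (x ∷ X) Y w = trans (cong (miss x w +_) (missL-++ X Y w)) (sym (+-assoc (miss x w) _ _))

  miss≡0 : ∀ {u w} → miss u w ≡ 0 → w ~ u
  miss≡0 {u} {w} e with adj G u w in eq
  ... | true = ~-sym eq

  missL≡0 : ∀ {L w} → missL L w ≡ 0 → All (w ~_) L
  missL≡0 {[]}    e = []
  missL≡0 {u ∷ L} e = miss≡0 (m+n≡0⇒m≡0 _ e) ∷ missL≡0 {L} (m+n≡0⇒n≡0 (miss u _) e)

  missL-filter : ∀ L w → missL L w + length (filter (w ~?_) L) ≡ length L
  missL-filter []      w = refl
  missL-filter (u ∷ L) w with adj G u w | adj G w u | proj₁ simple u w
  ... | true  | _ | refl = trans (+-suc _ _) (cong suc (missL-filter L w))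
  ... | false | _ | refl = cong suc (missL-filter L w)

  missL-total : ∀ L → q * ρ * sumFin (missL L) + length L * n ≤ length L * (3 * q * n)
  missL-total [] = ≤-reflexive (trans (+-identityʳ _) (trans (cong (q * ρ *_) (trans (sum-const n 0) (*-zeroʳ n))) (*-zeroʳ (q * ρ))))
  missL-total (u ∷ L) = begin
    q * ρ * sumFin (λ w → miss u w + missL L w) + (n + length L * n)
      ≡⟨ cong (λ s → q * ρ * s + (n + length L * n)) (sum-+ (miss u) (missL L)) ⟩
    q * ρ * (sumFin (miss u) + sumFin (missL L)) + (n + length L * n)
      ≡⟨ rearrange (q * ρ) (sumFin (miss u)) (sumFin (missL L)) n (length L * n) ⟩
    (q * ρ * sumFin (miss u) + n) + (q * ρ * sumFin (missL L) + length L * n)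
      ≤⟨ +-mono-≤ (few u) (missL-total L) ⟩
    3 * q * n + length L * (3 * q * n) ∎
    where
    open ≤-Reasoning
    rearrange : ∀ k a b n l → k * (a + b) + (n + l) ≡ (k * a + n) + (k * b + l)
    rearrange = solve-∀

  -- Every vertex is nonadjacent to fewer than 3n/ρ vertices, so the average of missL L is below 3 |L| / ρ ≤ τ.
  extension : ∀ L τ (good : V → ℕ) → 1 ≤ length L → 3 * length L ≤ τ * ρ →
    (∀ w → τ ≤ missL L w + τ * good w) → n ≤ τ * ρ * q * sumFin good
  extension L τ good l≥1 l≤ h = ≤-trans (≤-trans (≤-reflexive (sym (*-identityˡ n))) (*-monoˡ-≤ n l≥1))
    (ext-arith n q ρ τ (length L) (sumFin (missL L)) (sumFin good) summed (missL-total L) l≤)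
    where
    open ≤-Reasoning
    summed : τ * n ≤ sumFin (missL L) + τ * sumFin good
    summed = begin
      τ * n                                     ≡⟨ *-comm τ n ⟩
      n * τ                                     ≡⟨ sum-const n τ ⟨
      sumFin {n} (λ _ → τ)                      ≤⟨ sum-mono h ⟩
      sumFin (λ w → missL L w + τ * good w)     ≡⟨ sum-+ (missL L) (λ w → τ * good w) ⟩
      sumFin (missL L) + sumFin (λ w → τ * good w) ≡⟨ cong (sumFin (missL L) +_) (sum-* τ good) ⟩
      sumFin (missL L) + τ * sumFin good        ∎

  -- Explains the size of c: τ is at most 3, and m is 1 for a plain extension but `2 + r` when an
  -- index in the clique z has to be fixed as well.
  τρq≤c : ∀ {τ} → τ ≤ 3 → ∀ m → m ≤ 2 + r → m * (τ * ρ * q) ≤ c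
  τρq≤c τ≤ m m≤ = ≤-trans (*-mono-≤ m≤ (*-monoˡ-≤ q (*-monoˡ-≤ ρ τ≤))) (≤-reflexive (sym c≡))

  -- Contrapositive form of the averaging: it remains to show that every w at which the continuation
  -- fails misses weight τ.
  Rob-extension : ∀ {P} j t L τ → τ ≤ 3 → 1 ≤ length L → 3 * length L ≤ τ * ρ →
    (∀ w → Rob c j P (w ∷ t) ≢ true → τ ≤ missL L w) → Rob c (suc j) P t ≡ true
  Rob-extension {P} j t L τ τ≤3 l≥1 l≤ h = ⌊⌋⁺ (_ ≤? _) (begin
    n                    ≤⟨ extension L τ (λ w → ind (Rob c j P (w ∷ t))) l≥1 l≤ pointwise ⟩
    τ * ρ * q * g        ≤⟨ *-monoˡ-≤ g (≤-trans (≤-reflexive (sym (*-identityˡ _))) (τρq≤c τ≤3 1 (s≤s z≤n))) ⟩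
    c * g                ∎)
    where
    open ≤-Reasoning
    g : ℕ
    g = sumFin (λ w → ind (Rob c j P (w ∷ t)))
    pointwise : ∀ w → τ ≤ missL L w + τ * ind (Rob c j P (w ∷ t))
    pointwise w with Rob c j P (w ∷ t) in eq
    ... | true  = ≤-trans (≤-reflexive (sym (*-identityʳ τ))) (m≤n+m _ (missL L w))
    ... | false = ≤-trans (h w (λ e → contradiction (trans (sym e) eq) λ ())) (m≤m+n _ _)

  Rob-clique : ∀ m t → Clique t → m + length t ≡ 2 + r → Rob c m isK t ≡ true
  Rob-clique zero    t       ct e = ⌊⌋⁺ (allPairs? _~?_ t) ct
  -- The averaging needs a nonempty list, but any vertex can start a clique.
  Rob-clique (suc m) []      ct e = ⌊⌋⁺ (_ ≤? _) (begin
    n                                          ≡⟨ trans (sum-const n 1) (*-identityʳ n) ⟨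
    sumFin {n} (λ _ → 1)                       ≤⟨ sum-mono (λ w → ≤-reflexive (cong ind (sym (Rob-clique m (w ∷ []) ([] ∷ []) (trans (+-suc m 0) e))))) ⟩
    sumFin (λ w → ind (Rob c m isK (w ∷ [])))  ≤⟨ m≤n*m _ c ⟩
    c * sumFin (λ w → ind (Rob c m isK (w ∷ []))) ∎)
    where open ≤-Reasoning
  Rob-clique (suc m) t@(_ ∷ _) ct e = Rob-extension {isK} m t t 1 (s≤s z≤n) (s≤s z≤n) l≤ fails
    where
    open ≤-Reasoning
    l≤ : 3 * length t ≤ 1 * ρ
    l≤ = begin
      3 * length t        ≤⟨ *-monoʳ-≤ 3 (≤-trans (m≤n+m (length t) m) (≤-reflexive (suc-injective e))) ⟩
      3 * suc r           ≡⟨ *-suc 3 r ⟩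
      3 + 3 * r           ≡⟨ +-comm 3 (3 * r) ⟩
      3 * r + 3           ≤⟨ +-monoʳ-≤ (3 * r) (m≤m+n 3 2) ⟩
      3 * r + 5           ≡⟨ trans (*-identityˡ ρ) ρ≡ ⟨
      1 * ρ               ∎
    fails : ∀ w → Rob c m isK (w ∷ t) ≢ true → 1 ≤ missL t w
    fails w ¬rob with missL t w in eq
    ... | zero  = contradiction (Rob-clique m (w ∷ t) (missL≡0 eq ∷ ct) (trans (+-suc m _) e)) ¬rob
    ... | suc _ = s≤s z≤n

  Joined : List V → List V → Set
  Joined X Y = All (λ x → All (x ~_) Y) X

  ∷-⊆ : ∀ {w : V} {X t} → w ∈ t → X ⊆ t → (w ∷ X) ⊆ t
  ∷-⊆ w∈ X⊆ (here refl) = w∈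
  ∷-⊆ w∈ X⊆ (there u∈)  = X⊆ u∈

  ++-⊆ : ∀ (X {Y t} : List V) → X ⊆ t → Y ⊆ t → (X ++ Y) ⊆ t
  ++-⊆ X X⊆ Y⊆ u∈ with ∈-++⁻ X u∈
  ... | inj₁ u∈X = X⊆ u∈X
  ... | inj₂ u∈Y = Y⊆ u∈Y

  filter-⊆ : ∀ w (X : List V) → filter (w ~?_) X ⊆ X
  filter-⊆ w X u∈ = proj₁ (∈-filter⁻ (w ~?_) {xs = X} u∈)

  Joined-∷ : ∀ {w X Y} → All (w ~_) X → Joined X Y → Joined X (w ∷ Y)
  Joined-∷ wX XY = All.zipWith (λ (wx , xY) → ~-sym wx ∷ xY) (wX , XY)

  clique-∷++ : ∀ {v X Y} → Clique X → Clique Y → Joined X Y → All (v ~_) X → All (v ~_) Y → Clique (v ∷ X ++ Y)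
  clique-∷++ cX cY XY vX vY = Allₚ.++⁺ vX vY ∷ AllPairsₚ.++⁺ cX cY XY

  -- Brandt's wheel: A ∪ S is a clique in the common neighbourhood of x and v, B ∪ S one in that of y and v.
  record Wheel (l : ℕ) (t : List V) : Set where
    field
      v x y : V
      A B S : List V
      |A| : length A ≡ l
      |B| : length B ≡ l
      |S| : l + length S ≡ suc r
      cA : Clique A
      cB : Clique B
      cS : Clique S
      AS : Joined A S
      BS : Joined B S
      vA : All (v ~_) A
      vB : All (v ~_) B
      vS : All (v ~_) S
      xA : All (x ~_) A
      xS : All (x ~_) S
      yB : All (y ~_) B
      yS : All (y ~_) S
      xy : x ~ y
      v∈ : v ∈ t
      x∈ : x ∈ t
      y∈ : y ∈ t
      A⊆ : A ⊆ t
      B⊆ : B ⊆ t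
      S⊆ : S ⊆ t

  -- Induction on the number l of vertices that the common part `S` still lacks; at `l = 0` the edge
  -- xy and `S` form K_{r+3}.
  wheel⇒Rob : ∀ l t → Wheel l t → Rob c l (hasK (3 + r)) t ≡ true
  wheel⇒Rob zero t W = hasK⁺ (x ∷ y ∷ S) (cong (2 +_) |S|) ((xy ∷ xS) ∷ yS ∷ cS) (∷-⊆ x∈ (∷-⊆ y∈ S⊆))
    where open Wheel W
  wheel⇒Rob (suc l) t W = Rob-extension {hasK (3 + r)} l t L 3 ≤-refl (s≤s z≤n) (*-monoʳ-≤ 3 |L|≤) fails
    where
    open Wheel W
    L : List V
    -- A miss in `S` cannot be repaired, hence its weight 3. The total is `3r + 5 - l`, so `ρ` is
    -- attained exactly in the last enlargement, `l = 0`.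
    L = v ∷ x ∷ y ∷ A ++ B ++ S ++ S ++ S
    |L|≤ : length L ≤ ρ
    |L|≤ = begin
      3 + length (A ++ B ++ S ++ S ++ S)
        ≡⟨ cong (3 +_) (trans (length-++ A) (cong₂ _+_ |A| (trans (length-++ B) (cong₂ _+_ |B|
             (trans (length-++ S) (cong (length S +_) (length-++ S))))))) ⟩
      3 + (suc l + (suc l + (length S + (length S + length S))))
        ≤⟨ m≤m+n _ l ⟩
      3 + (suc l + (suc l + (length S + (length S + length S)))) + l
        ≡⟨ rearrange l (length S) ⟩
      3 * (l + length S) + 5
        ≡⟨ cong (λ m → 3 * m + 5) (suc-injective |S|) ⟩
      3 * r + 5
        ≡⟨ ρ≡ ⟨
      ρ ∎
      where
      open ≤-Reasoning
      rearrange : ∀ l k → 3 + (suc l + (suc l + (k + (k + k)))) + l ≡ 3 * (l + k) + 5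
      rearrange = solve-∀
    fails : ∀ w → Rob c l (hasK (3 + r)) (w ∷ t) ≢ true → 3 ≤ missL L w
    fails w ¬rob = subst (3 ≤_) (sym splitL)
      (wheel-misses≥3 (miss v w) (miss x w) (miss y w) (missL A w) (missL B w) (missL S w)
        (no-clique v∈ |A| cA AS vA vS A⊆) (no-clique x∈ |A| cA AS xA xS A⊆)
        (no-clique v∈ |B| cB BS vB vS B⊆) (no-clique y∈ |B| cB BS yB yS B⊆) no-wheel)
      where
      splitL : missL L w ≡ miss v w + (miss x w + (miss y w +
                 (missL A w + (missL B w + (missL S w + (missL S w + missL S w))))))
      splitL = cong (λ m → miss v w + (miss x w + (miss y w + m)))
        (trans (missL-++ A _ w) (cong (missL A w +_) (trans (missL-++ B _ w) (cong (missL B w +_)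
          (trans (missL-++ S _ w) (cong (missL S w +_) (missL-++ S S w)))))))
      -- Otherwise w, u, `X` and `S` form K_{r+3}, and the remaining steps are idle.
      no-clique : ∀ {u X} → u ∈ t → length X ≡ suc l → Clique X → Joined X S → All (u ~_) X → All (u ~_) S →
        X ⊆ t → missL S w ≡ 0 → 0 < miss u w + missL X w
      no-clique {u} {X} u∈ |X| cX XS uX uS X⊆ mS with miss u w + missL X w in eq
      ... | suc _ = s≤s z≤n
      ... | zero  = contradiction (Rob-weaken c l (hasK-mono (3 + r)) (w ∷ t)
        (hasK⁺ (w ∷ u ∷ X ++ S)
          (cong (2 +_) (trans (length-++ X {S}) (trans (cong (_+ length S) |X|) |S|)))
          ((miss≡0 (m+n≡0⇒m≡0 _ eq) ∷ Allₚ.++⁺ (missL≡0 {X} (m+n≡0⇒n≡0 (miss u w) eq)) (missL≡0 {S} mS))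
            ∷ clique-∷++ cX (cS) XS uX uS)
          (∷-⊆ (here refl) (there ∘ ∷-⊆ u∈ (++-⊆ X X⊆ S⊆))))) ¬rob
      shrink : ∀ X → length X ≡ suc l → missL X w ≡ 1 → length (filter (w ~?_) X) ≡ l
      shrink X |X| m = suc-injective (trans (cong (_+ length (filter (w ~?_) X)) (sym m)) (trans (missL-filter X w) |X|))
      -- The only non-neighbours of w in `A` and in `B` are dropped and w joins `S`.
      no-wheel : miss v w ≡ 0 → miss x w ≡ 0 → miss y w ≡ 0 → missL A w ≡ 1 → missL B w ≡ 1 → missL S w ≡ 0 → ⊥
      no-wheel mv mx my mA mB mS = ¬rob (wheel⇒Rob l (w ∷ t) record
        { v = v ; x = x ; y = y ; A = filter (w ~?_) A ; B = filter (w ~?_) B ; S = w ∷ S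
        ; |A| = shrink A |A| mA ; |B| = shrink B |B| mB ; |S| = trans (+-suc l (length S)) |S|
        ; cA = AllPairsₚ.filter⁺ (w ~?_) cA ; cB = AllPairsₚ.filter⁺ (w ~?_) cB ; cS = missL≡0 {S} mS ∷ cS
        ; AS = Joined-∷ (Allₚ.all-filter (w ~?_) A) (Allₚ.filter⁺ (w ~?_) AS)
        ; BS = Joined-∷ (Allₚ.all-filter (w ~?_) B) (Allₚ.filter⁺ (w ~?_) BS)
        ; vA = Allₚ.filter⁺ (w ~?_) vA ; vB = Allₚ.filter⁺ (w ~?_) vB ; vS = ~-sym (miss≡0 mv) ∷ vS
        ; xA = Allₚ.filter⁺ (w ~?_) xA ; xS = ~-sym (miss≡0 mx) ∷ xS
        ; yB = Allₚ.filter⁺ (w ~?_) yB ; yS = ~-sym (miss≡0 my) ∷ yS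
        ; xy = xy ; v∈ = there v∈ ; x∈ = there x∈ ; y∈ = there y∈
        ; A⊆ = there ∘ A⊆ ∘ filter-⊆ w A ; B⊆ = there ∘ B⊆ ∘ filter-⊆ w B
        ; S⊆ = ∷-⊆ (here refl) (there ∘ S⊆) })

  common? : ∀ x v u → Dec (x ~ u × v ~ u)
  common? x v u = (x ~? u) ×-dec (v ~? u)

  -- The second disjunct absorbs the case that K_{r+3} has already appeared in t.
  link : V → V → List V → Bool
  link x v t = hasK (suc r) (filter (common? x v) t) ∨ hasK (3 + r) t

  link-mono : ∀ x v → Monotone (link x v)
  link-mono x v {t} {t′} t⊆ h with ∨⁻ (hasK (suc r) (filter (common? x v) t)) _ h
  ... | inj₁ k = ∨⁺ˡ (hasK-mono (suc r) (λ u∈ → let u∈t , p = ∈-filter⁻ (common? x v) {xs = t} u∈ in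
                                           ∈-filter⁺ (common? x v) (t⊆ u∈t) p) k)
  ... | inj₂ k = ∨⁺ʳ (hasK (suc r) (filter (common? x v) t′)) (hasK-mono (3 + r) t⊆ k)

  -- The clique I ∪ J evolves from z by replacing a vertex of I with a neighbour w of x, which joins J.
  -- Once I = {v}, the clique J lies in the common neighbourhood of x and v.
  attach : ∀ k t x (z : List V) I J → Fin (length z) → length z ≡ 2 + r → length I ≤ suc k →
    length I + length J ≡ 2 + r → Clique I → Clique J → Joined I J → All (x ~_) J → I ⊆ z →
    x ∈ t → I ⊆ t → J ⊆ t → ∃ λ i → Rob c k (link x (lookup z i)) t ≡ true
  -- Here x and `J` already form K_{r+3}, so the index may be arbitrary.
  attach k t x z [] J i₀ |z| _ |IJ| cI cJ IJ xJ I⊆z x∈ I⊆ J⊆ =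
    i₀ , Rob-weaken c k (link-mono x (lookup z i₀)) t
           (∨⁺ʳ (hasK (suc r) (filter (common? x (lookup z i₀)) t))
             (hasK⁺ (x ∷ J) (cong suc |IJ|) (xJ ∷ cJ) (∷-⊆ x∈ J⊆)))
  attach k t x z (v ∷ []) J i₀ |z| _ |IJ| cI cJ (vJ ∷ []) xJ I⊆z x∈ I⊆ J⊆ =
    index v∈z , subst (λ u → Rob c k (link x u) t ≡ true) (lookup-index v∈z)
      (Rob-weaken c k (link-mono x v) t (∨⁺ˡ (hasK⁺ J (suc-injective |IJ|) cJ
        λ u∈ → ∈-filter⁺ (common? x v) (J⊆ u∈) (All.lookup xJ u∈ , All.lookup vJ u∈))))
    where
    v∈z : v ∈ z
    v∈z = I⊆z (here refl)
  attach zero t x z (_ ∷ _ ∷ _) J i₀ |z| (s≤s ())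
  attach (suc k) t x z I@(_ ∷ _ ∷ I″) J i₀ |z| |I|≤ |IJ| cI cJ IJ xJ I⊆z x∈ I⊆ J⊆ =
    -- The index obtained below depends on w; the one that occurs for most w is taken, at the cost
    -- of a factor `length z`.
    let i , S≤ = sum≤max (λ i → sumFin (λ w → ind (rob i w))) i₀ in
    i , ⌊⌋⁺ (_ ≤? _) (begin
      n ≤⟨ extension L 2 (λ w → sumFin (λ i → ind (rob i w))) (s≤s z≤n) |L|≤ pointwise ⟩
      2 * ρ * q * sumFin (λ w → sumFin (λ i → ind (rob i w)))
        ≡⟨ cong (2 * ρ * q *_) (sum-swap (λ w i → ind (rob i w))) ⟩
      2 * ρ * q * sumFin (λ i → sumFin (λ w → ind (rob i w)))
        ≤⟨ *-monoʳ-≤ (2 * ρ * q) S≤ ⟩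
      2 * ρ * q * (length z * sumFin (λ w → ind (rob i w)))
        ≡⟨ swap (2 * ρ * q) (length z) _ ⟩
      length z * (2 * ρ * q) * sumFin (λ w → ind (rob i w))
        ≤⟨ *-monoˡ-≤ _ (τρq≤c (s≤s (s≤s z≤n)) (length z) (≤-reflexive |z|)) ⟩
      c * sumFin (λ w → ind (rob i w)) ∎)
    where
    open ≤-Reasoning
    swap : ∀ a b d → a * (b * d) ≡ b * a * d
    swap = solve-∀
    rob : Fin (length z) → V → Bool
    rob i w = Rob c k (link x (lookup z i)) (w ∷ t)
    L : List V
    -- `J` is doubled because w must be adjacent to all of it. If w misses weight at most 1, then
    -- either it is adjacent to all of `I` and `J`, giving K_{r+3}, or it is adjacent to x and `J`
    -- and replaces its single non-neighbour in `I`.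
    L = x ∷ I ++ J ++ J
    |L|≤ : 3 * length L ≤ 2 * ρ
    |L|≤ = begin
      3 * suc (length (I ++ J ++ J))
        ≡⟨ cong (λ m → 3 * suc m) (trans (length-++ I) (cong (length I +_) (length-++ J))) ⟩
      3 * suc (length I + (length J + length J))
        ≤⟨ *-monoʳ-≤ 3 (s≤s (m≤m+n (length I + (length J + length J)) (length I″))) ⟩
      3 * suc (length I + (length J + length J) + length I″)
        ≡⟨ cong (3 *_) (double (length I″) (length J)) ⟩
      3 * (2 * (length I″ + length J) + 3)
        ≡⟨ cong (λ m → 3 * (2 * m + 3)) (suc-injective (suc-injective |IJ|)) ⟩
      3 * (2 * r + 3)
        ≤⟨ m≤m+n _ 1 ⟩
      3 * (2 * r + 3) + 1
        ≡⟨ regroup r ⟩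
      2 * (3 * r + 5)
        ≡⟨ cong (2 *_) ρ≡ ⟨
      2 * ρ ∎
      where
      double : ∀ i j → suc (suc (suc i) + (j + j) + i) ≡ 2 * (i + j) + 3
      double = solve-∀
      regroup : ∀ r → 3 * (2 * r + 3) + 1 ≡ 2 * (3 * r + 5)
      regroup = solve-∀
    found : ∀ w i → rob i w ≡ true → 2 ≤ missL L w + 2 * sumFin (λ i → ind (rob i w))
    found w i e = ≤-trans (*-monoʳ-≤ 2 (≤-trans (≤-reflexive (cong ind (sym e))) (term≤sum (λ i → ind (rob i w)) i)))
                          (m≤n+m _ (missL L w))
    pointwise : ∀ w → 2 ≤ missL L w + 2 * sumFin (λ i → ind (rob i w))
    pointwise w with any? (λ i → rob i w Bool.≟ true)
    ... | yes (i , e) = found w i e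
    ... | no ¬rob = ≤-trans (subst (2 ≤_) (sym splitL)
                      (swap-misses≥2 (miss x w) (missL I w) (missL J w) no-clique no-swap)) (m≤m+n _ _)
      where
      splitL : missL L w ≡ miss x w + (missL I w + (missL J w + missL J w))
      splitL = cong (miss x w +_) (trans (missL-++ I _ w) (cong (missL I w +_) (missL-++ J J w)))
      no-clique : missL I w ≡ 0 → missL J w ≡ 0 → ⊥
      no-clique mI mJ = ¬rob (i₀ , Rob-weaken c k (link-mono x (lookup z i₀)) (w ∷ t)
        (∨⁺ʳ (hasK (suc r) (filter (common? x (lookup z i₀)) (w ∷ t)))
          (hasK⁺ (w ∷ I ++ J) (cong suc (trans (length-++ I) |IJ|))
            (Allₚ.++⁺ (missL≡0 {I} mI) (missL≡0 {J} mJ) ∷ AllPairsₚ.++⁺ cI cJ IJ)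
            (∷-⊆ (here refl) (there ∘ ++-⊆ I I⊆ J⊆)))))
      I′ : List V
      I′ = filter (w ~?_) I
      no-swap : miss x w ≡ 0 → missL I w ≡ 1 → missL J w ≡ 0 → ⊥
      no-swap mx mI mJ = ¬rob (attach k (w ∷ t) x z I′ (w ∷ J) i₀ |z|
        (s≤s⁻¹ (≤-trans (≤-reflexive |I′|) |I|≤))
        (trans (+-suc _ _) (trans (cong (_+ length J) |I′|) |IJ|))
        (AllPairsₚ.filter⁺ (w ~?_) cI) (missL≡0 {J} mJ ∷ cJ)
        (Joined-∷ (Allₚ.all-filter (w ~?_) I) (Allₚ.filter⁺ (w ~?_) IJ))
        (~-sym (miss≡0 mx) ∷ xJ) (I⊆z ∘ filter-⊆ w I)
        (there x∈) (there ∘ I⊆ ∘ filter-⊆ w I) (∷-⊆ (here refl) (there ∘ J⊆)))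
        where
        |I′| : suc (length I′) ≡ length I
        |I′| = trans (cong (_+ length I′) (sym mI)) (missL-filter I w)

  link⁻ : ∀ x v t → link x v t ≡ true →
    (∃ λ Q → length Q ≡ suc r × Clique Q × All (x ~_) Q × All (v ~_) Q × Q ⊆ t) ⊎ hasK (3 + r) t ≡ true
  link⁻ x v t h with ∨⁻ (hasK (suc r) (filter (common? x v) t)) _ h
  ... | inj₂ k = inj₂ k
  ... | inj₁ k = let Q , l , cQ , Q⊆ = hasK⁻ {suc r} k
                     mem : ∀ {u} → u ∈ Q → u ∈ t × (x ~ u × v ~ u)
                     mem u∈ = ∈-filter⁻ (common? x v) {xs = t} (Q⊆ u∈)
                 in inj₁ (Q , l , cQ , All.tabulate (proj₁ ∘ proj₂ ∘ mem) , All.tabulate (proj₂ ∘ proj₂ ∘ mem) , proj₁ ∘ mem)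

  -- `suc r` steps each for the clique linking x to v, the one linking y to v, and the closing of
  -- the wheel.
  depth : ℕ
  depth = suc r + (suc r + suc r)

  linked⇒Rob : ∀ z x y v → v ∈ z → x ~ y →
    Rob c (suc r) (link x v) (x ∷ z) ≡ true → Rob c (suc r) (link y v) (y ∷ z) ≡ true →
    Rob c depth (hasK (3 + r)) (y ∷ x ∷ z) ≡ true
  linked⇒Rob z x y v v∈ xy hx hy =
    Rob-bind c (suc r) (suc r + suc r) {link x v} (y ∷ x ∷ z) first (Rob-⊆ c (suc r) (link-mono x v) there hx)
    where
    weaken : ∀ j {t} → hasK (3 + r) t ≡ true → Rob c j (hasK (3 + r)) t ≡ true
    weaken j {t} = Rob-weaken c j (hasK-mono (3 + r)) t
    first : ∀ {t} → (y ∷ x ∷ z) ⊆ t → link x v t ≡ true → Rob c (suc r + suc r) (hasK (3 + r)) t ≡ true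
    first {t} t⊇ lx with link⁻ x v t lx
    ... | inj₂ k = weaken (suc r + suc r) k
    ... | inj₁ (A , |A| , cA , xA , vA , A⊆) =
      Rob-bind c (suc r) (suc r) {link y v} t second (Rob-⊆ c (suc r) (link-mono y v) (t⊇ ∘ ∷⁺ʳ y there) hy)
      where
      second : ∀ {t′} → t ⊆ t′ → link y v t′ ≡ true → Rob c (suc r) (hasK (3 + r)) t′ ≡ true
      second {t′} t⊆ ly with link⁻ y v t′ ly
      ... | inj₂ k = weaken (suc r) k
      ... | inj₁ (B , |B| , cB , yB , vB , B⊆) = wheel⇒Rob (suc r) t′ record
        -- The initial wheel has an empty common part: the two linking cliques were found
        -- independently.
        { v = v ; x = x ; y = y ; A = A ; B = B ; S = []
        ; |A| = |A| ; |B| = |B| ; |S| = +-identityʳ (suc r)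
        ; cA = cA ; cB = cB ; cS = [] ; AS = All.tabulate (λ _ → []) ; BS = All.tabulate (λ _ → [])
        ; vA = vA ; vB = vB ; vS = [] ; xA = xA ; xS = [] ; yB = yB ; yS = [] ; xy = xy
        ; v∈ = t⊆ (t⊇ (there (there v∈))) ; x∈ = t⊆ (t⊇ (there (here refl))) ; y∈ = t⊆ (t⊇ (here refl))
        ; A⊆ = t⊆ ∘ A⊆ ; B⊆ = B⊆ ; S⊆ = λ () }

  -- From few cliques to a partition

  forced : List V → ℕ
  forced t = ind (Rob c depth (hasK (3 + r)) t)

  forcedPairs : List V → ℕ
  forcedPairs z = sumFin λ y → sumFin λ x → forced (y ∷ x ∷ z)

  many-cliques : n ^ (2 + r) ≤ c ^ (2 + r) * sumL (2 + r) (λ t → ind (isK t))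
  many-cliques = ≤-trans (≤-reflexive (trans (sym (*-identityʳ _))
      (cong (λ b → n ^ (2 + r) * ind b) (sym (Rob-clique (2 + r) [] [] (+-identityʳ (2 + r)))))))
    (subst (λ m → n ^ (2 + r) * ind (Rob c (2 + r) isK []) ≤ c ^ (2 + r) * sumL m (λ t → ind (isK t)))
      (+-identityʳ (2 + r)) (Rob-count c (2 + r) 0 isK))

  -- A forced tuple has many extensions to N-tuples containing K_{r+3}, and few cliques leave few
  -- such N-tuples. The bound is stated relative to the number of (r+2)-cliques, so that it can be
  -- averaged over them.
  few-cliques⇒few-forced : ∀ e N → N ≡ depth + (4 + r) → 1 ≤ n →
    e * c ^ (2 + r) * (c ^ depth * 2 ^ N) * sumL (3 + r) (λ t → ind (isK t)) ≤ n ^ (3 + r) →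
    e * sumL (4 + r) forced ≤ n * n * sumL (2 + r) (λ t → ind (isK t))
  few-cliques⇒few-forced e N N≡ n≥1 few-K = average-arith e (c ^ depth * 2 ^ N) (c ^ (2 + r)) (n ^ (3 + r)) (n ^ depth)
      (n * n) (n ^ (2 + r)) (sumL (4 + r) forced) (sumL N (λ t → ind (hasK (3 + r) t)))
      (sumL (3 + r) (λ t → ind (isK t))) (sumL (2 + r) (λ t → ind (isK t))) (c ^ depth) (2 ^ N) refl
      many-cliques
      (subst (λ m → n ^ depth * sumL (4 + r) forced ≤ c ^ depth * sumL m (λ t → ind (hasK (3 + r) t)))
        (sym N≡) (Rob-count c depth (4 + r) (hasK (3 + r))))
      (≤-trans (someSublist-count isK N (3 + r)) (≤-reflexive (cong (λ m → 2 ^ N * (m * sumL (3 + r) (λ t → ind (isK t)))) n^N)))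
      few-K
    where
    instance
      n≢0 : NonZero n
      n≢0 = >-nonZero n≥1
      i₁ : NonZero (c ^ depth * 2 ^ N)
      i₁ = m*n≢0 _ _ {{m^n≢0 c depth}} {{m^n≢0 2 N}}
      i₂ : NonZero (c ^ (2 + r))
      i₂ = m^n≢0 c (2 + r)
      i₃ : NonZero (n ^ (3 + r))
      i₃ = m^n≢0 n (3 + r)
      i₄ : NonZero (n ^ depth)
      i₄ = m^n≢0 n depth
    n^N : n ^ N ≡ n ^ depth * (n * n * n ^ (2 + r))
    n^N = trans (cong (n ^_) N≡) (trans (^-distribˡ-+-* n depth (4 + r)) (cong (n ^ depth *_) (sym (*-assoc n n _))))

  good-clique : ∀ e → e * sumL (4 + r) forced ≤ n * n * sumL (2 + r) (λ t → ind (isK t)) →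
    1 ≤ sumL (2 + r) (λ t → ind (isK t)) →
    ∃ λ z → length z ≡ 2 + r × Clique z × e * forcedPairs z ≤ n * n
  good-clique e h κ≥1 =
    -- The indicator on both sides forces the selected z to be a clique; `suc (n * n)` makes the
    -- inequality of the sums strict.
    let z , |z| , lt = sumL-pick (2 + r) (λ z → ind (isK z) * (e * forcedPairs z)) (λ z → ind (isK z) * suc (n * n)) total
        cz , le = decode (isK z) lt
    in z , |z| , ⌊⌋⁻ (allPairs? _~?_ z) cz , le
    where
    open ≤-Reasoning
    κ : ℕ
    κ = sumL (2 + r) (λ t → ind (isK t))
    decode : ∀ b {a m} → ind b * a < ind b * suc m → b ≡ true × a ≤ m
    decode true {a} {m} lt = refl , s≤s⁻¹ (subst (λ k → suc k ≤ suc m) (+-identityʳ a) (subst (a + 0 <_) (+-identityʳ (suc m)) lt))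
    total : sumL (2 + r) (λ z → ind (isK z) * (e * forcedPairs z)) < sumL (2 + r) (λ z → ind (isK z) * suc (n * n))
    total = begin-strict
      sumL (2 + r) (λ z → ind (isK z) * (e * forcedPairs z))
        ≤⟨ sumL-mono (2 + r) (λ z _ → ≤-trans (*-monoˡ-≤ (e * forcedPairs z) (ind≤1 (isK z))) (≤-reflexive (*-identityˡ (e * forcedPairs z)))) ⟩
      sumL (2 + r) (λ z → e * forcedPairs z)
        ≡⟨ sumL-* (2 + r) e forcedPairs ⟩
      e * sumL (2 + r) forcedPairs
        ≡⟨ cong (e *_) (trans (sumL-swap (2 + r) (λ y z → sumFin λ x → forced (y ∷ x ∷ z)))
             (sum-cong λ y → sumL-swap (2 + r) (λ x z → forced (y ∷ x ∷ z)))) ⟩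
      e * sumL (4 + r) forced
        ≤⟨ h ⟩
      n * n * κ
        <⟨ m<n+m (n * n * κ) κ≥1 ⟩
      suc (n * n) * κ
        ≡⟨ sumL-* (2 + r) (suc (n * n)) (λ z → ind (isK z)) ⟨
      sumL (2 + r) (λ z → suc (n * n) * ind (isK z))
        ≡⟨ sumL-cong (2 + r) (λ z → *-comm (suc (n * n)) (ind (isK z))) ⟩
      sumL (2 + r) (λ z → ind (isK z) * suc (n * n)) ∎

  -- The class of x is the index in z to which x can be attached, starting from `I = z` and `J`
  -- empty. Two adjacent vertices of one class are linked to the same vertex of z, hence form a
  -- forced tuple with z.
  clique⇒partition : ∀ z → length z ≡ 2 + r → Clique z → Σ (V → Fin (2 + r)) λ class →
    sumFin (λ x → sumFin (λ y → ind (adj G x y ∧ ⌊ class x Fin.≟ class y ⌋))) ≤ forcedPairs z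
  clique⇒partition z |z| cz = class ,
    ≤-trans (sum-mono λ x → sum-mono λ y → ind-mono (same x y))
      (≤-reflexive (sum-swap (λ x y → forced (y ∷ x ∷ z))))
    where
    at : ∀ x → ∃ λ i → Rob c (suc r) (link x (lookup z i)) (x ∷ z) ≡ true
    at x = attach (suc r) (x ∷ z) x z z [] (subst Fin (sym |z|) zero) |z| (≤-reflexive |z|)
      (trans (+-identityʳ _) |z|) cz [] (All.tabulate λ _ → []) [] id (here refl) there (λ ())
    class : V → Fin (2 + r)
    class x = subst Fin |z| (proj₁ (at x))
    same : ∀ x y → adj G x y ∧ ⌊ class x Fin.≟ class y ⌋ ≡ true → Rob c depth (hasK (3 + r)) (y ∷ x ∷ z) ≡ true
    same x y h with ∧⁻ (adj G x y) _ h
    ... | xy , e = linked⇒Rob z x y (lookup z (proj₁ (at x))) (∈-lookup (proj₁ (at x))) xy (proj₂ (at x))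
      (subst (λ i → Rob c (suc r) (link y (lookup z i)) (y ∷ z) ≡ true)
        (sym (subst-injective |z| (⌊⌋⁻ (class x Fin.≟ class y) e))) (proj₂ (at y)))

  few-cliques⇒partition : ∀ e N → N ≡ depth + (4 + r) → 1 ≤ n →
    e * c ^ (2 + r) * (c ^ depth * 2 ^ N) * sumL (3 + r) (λ t → ind (isK t)) ≤ n ^ (3 + r) →
    Σ (V → Fin (2 + r)) λ class →
      e * sumFin (λ x → sumFin (λ y → ind (adj G x y ∧ ⌊ class x Fin.≟ class y ⌋))) ≤ n * n
  few-cliques⇒partition e N N≡ n≥1 few-K =
    let z , |z| , cz , bound = good-clique e (few-cliques⇒few-forced e N N≡ n≥1 few-K) some-clique
        class , le = clique⇒partition z |z| cz
    in class , ≤-trans (*-monoʳ-≤ e le) bound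
    where
    some-clique : 1 ≤ sumL (2 + r) (λ t → ind (isK t))
    some-clique with sumL (2 + r) (λ t → ind (isK t)) | many-cliques
    ... | zero  | h = contradiction (≤-trans (m^n>0 n {{>-nonZero n≥1}} (2 + r)) (≤-trans h (≤-reflexive (*-zeroʳ (c ^ (2 + r)))))) λ ()
    ... | suc _ | _ = s≤s z≤n

-- The upper bound

withAdj : (G : Graph) → (Fin (size G) → Fin (size G) → Bool) → Graph
withAdj G a′ = record { size = size G ; adj = a′ }

lostEdge : (G : Graph) (a′ : Fin (size G) → Fin (size G) → Bool) → Fin (size G) → Fin (size G) → Bool
lostEdge G a′ u v = adj G u v ∧ not (a′ u v)

module LostEdges (G : Graph) (simple : IsSimple G) (a′ : Fin (size G) → Fin (size G) → Bool)
  (simple′ : IsSimple (withAdj G a′))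
  (sub : ∀ u v → a′ u v ≡ true → adj G u v ≡ true) where

  private
    V : Set
    V = Fin (size G)
    G′ : Graph
    G′ = withAdj G a′
    lost : V → V → Bool
    lost = lostEdge G a′
    before : V → V → Bool
    before u v = ⌊ toℕ u <? toℕ v ⌋

  ordered : ℕ
  ordered = sumFin λ u → sumFin λ v → ind (before u v ∧ lost u v)

  edges-as-sum : ∀ (b : V → V → Bool) →
    edges (withAdj G b) ≡ sumFin λ u → sumFin λ v → ind (before u v ∧ b u v)
  edges-as-sum b = sum-cong λ u → count≡sum (λ v → before u v ∧ b u v)

  -- The truncated subtraction is exact because `G′` is a subgraph of `G`.
  edges-lost : edges G ∸ edges G′ ≡ ordered
  edges-lost = trans (cong (_∸ edges G′) edges≡) (m+n∸m≡n (edges G′) ordered)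
    where
    pointwise : ∀ l a b → (b ≡ true → a ≡ true) → ind (l ∧ a) ≡ ind (l ∧ b) + ind (l ∧ (a ∧ not b))
    pointwise false a     b     h = refl
    pointwise true  true  true  h = refl
    pointwise true  true  false h = refl
    pointwise true  false false h = refl
    pointwise true  false true  h with h refl
    ... | ()
    edges≡ : edges G ≡ edges G′ + ordered
    edges≡ = begin
      edges G
        ≡⟨ edges-as-sum (adj G) ⟩
      (sumFin λ u → sumFin λ v → ind (before u v ∧ adj G u v))
        ≡⟨ sum-cong (λ u → trans (sum-cong λ v → pointwise (before u v) (adj G u v) (a′ u v) (sub u v))
             (sum-+ (λ v → ind (before u v ∧ a′ u v)) (λ v → ind (before u v ∧ lost u v)))) ⟩
      (sumFin λ u → (sumFin λ v → ind (before u v ∧ a′ u v)) + (sumFin λ v → ind (before u v ∧ lost u v)))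
        ≡⟨ sum-+ (λ u → sumFin λ v → ind (before u v ∧ a′ u v)) (λ u → sumFin λ v → ind (before u v ∧ lost u v)) ⟩
      (sumFin λ u → sumFin λ v → ind (before u v ∧ a′ u v)) + ordered
        ≡⟨ cong (_+ ordered) (edges-as-sum a′) ⟨
      edges G′ + ordered ∎
      where open ≡-Reasoning

  edges-lost≤ : edges G ∸ edges G′ ≤ sumFin λ u → sumFin λ v → ind (lost u v)
  edges-lost≤ = ≤-trans (≤-reflexive edges-lost)
    (sum-mono λ u → sum-mono λ v → ind-mono {before u v ∧ lost u v} (proj₂ ∘ ∧⁻ (before u v) _))

  lost-sym : ∀ u v → lost u v ≡ lost v u
  lost-sym u v = cong₂ (λ a b → a ∧ not b) (proj₁ simple u v) (proj₁ simple′ u v)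

  lost≤edges-lost : (sumFin λ u → sumFin λ v → ind (lost u v)) ≤ 2 * (edges G ∸ edges G′)
  lost≤edges-lost = begin
    (sumFin λ u → sumFin λ v → ind (lost u v))
      ≤⟨ sum-mono (λ u → sum-mono λ v → pointwise u v) ⟩
    (sumFin λ u → sumFin λ v → ind (before u v ∧ lost u v) + ind (before v u ∧ lost v u))
      ≡⟨ sum-cong (λ u → sum-+ (λ v → ind (before u v ∧ lost u v)) (λ v → ind (before v u ∧ lost v u))) ⟩
    (sumFin λ u → (sumFin λ v → ind (before u v ∧ lost u v)) + (sumFin λ v → ind (before v u ∧ lost v u)))
      ≡⟨ sum-+ (λ u → sumFin λ v → ind (before u v ∧ lost u v)) (λ u → sumFin λ v → ind (before v u ∧ lost v u)) ⟩
    ordered + (sumFin λ u → sumFin λ v → ind (before v u ∧ lost v u))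
      ≡⟨ cong (ordered +_) (sum-swap (λ u v → ind (before v u ∧ lost v u))) ⟩
    ordered + ordered
      ≡⟨ cong₂ _+_ (sym edges-lost) (trans (sym edges-lost) (sym (+-identityʳ _))) ⟩
    2 * (edges G ∸ edges G′) ∎
    where
    open ≤-Reasoning
    pointwise : ∀ u v → ind (lost u v) ≤ ind (before u v ∧ lost u v) + ind (before v u ∧ lost v u)
    pointwise u v with toℕ u <? toℕ v | toℕ v <? toℕ u
    ... | yes _ | _     = m≤m+n _ _
    ... | no _  | yes _ = ≤-reflexive (cong ind (lost-sym u v))
    ... | no ¬p | no ¬q with toℕ-injective (≤-antisym (≮⇒≥ ¬q) (≮⇒≥ ¬p))
    ... | refl rewrite proj₂ simple u = z≤n

K-adj⁻ : ∀ {m} {u v : Fin m} → adj (K m) u v ≡ true → u ≢ v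
K-adj⁻ {u = u} {v} h e with u Fin.≟ v
K-adj⁻ () e | yes _
... | no ¬e = ¬e e

K-adj⁺ : ∀ {m} {u v : Fin m} → u ≢ v → adj (K m) u v ≡ true
K-adj⁺ {u = u} {v} h with u Fin.≟ v
... | yes e = contradiction e h
... | no  _ = refl

tabulate-AllPairs⁻ : ∀ {A : Set} {R : A → A → Set} → (∀ {x y} → R x y → R y x) →
  ∀ {n} (f : Fin n → A) → AllPairs R (tabulate f) → ∀ i j → i ≢ j → R (f i) (f j)
tabulate-AllPairs⁻ s f (_ ∷ _)  zero    zero    ne = contradiction refl ne
tabulate-AllPairs⁻ s f (a ∷ _)  zero    (suc j) ne = Allₚ.tabulate⁻ a j
tabulate-AllPairs⁻ s f (a ∷ _)  (suc i) zero    ne = s (Allₚ.tabulate⁻ a i)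
tabulate-AllPairs⁻ s f (_ ∷ ps) (suc i) (suc j) ne = tabulate-AllPairs⁻ s (f ∘ suc) ps i j (ne ∘ cong suc)

module _ (H : Graph) (s : ℕ) (χ : Hom H (K s)) (G : Graph) (simple : IsSimple G) where
  open Cliques G simple

  -- Vertex u of `H` goes to the u-th element of the side given by its colour. Sides of a box may
  -- overlap, but images of differently coloured vertices are adjacent, hence distinct.
  Box⇒ContainsSub : Box isK s (size H) → ContainsSub G H
  Box⇒ContainsSub (f , f-inj , cliques) = emb , emb-inj , λ u v uv → emb-adj u v (K-adj⁻ (proj₂ χ u v uv))
    where
    col : Fin (size H) → Fin s
    col = proj₁ χ
    emb : Fin (size H) → V
    emb u = f (col u) u
    emb-adj : ∀ u v → col u ≢ col v → emb u ~ emb v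
    emb-adj u v ne = subst₂ _~_ (cong (f (col u)) pick-u) (cong (f (col v)) pick-v)
      (tabulate-AllPairs⁻ ~-sym (λ i → f i (pick i)) (⌊⌋⁻ (allPairs? _~?_ _) (cliques pick)) (col u) (col v) ne)
      where
      -- A transversal of the box through the images of both u and v.
      pick : Fin s → Fin (size H)
      pick i = if ⌊ i Fin.≟ col u ⌋ then u else v
      pick-u : pick (col u) ≡ u
      pick-u with col u Fin.≟ col u
      ... | yes _ = refl
      ... | no ¬e = contradiction refl ¬e
      pick-v : pick (col v) ≡ v
      pick-v with col v Fin.≟ col u
      ... | yes e = contradiction (sym e) ne
      ... | no  _ = refl
    emb-inj : Injective _≡_ _≡_ emb
    emb-inj {u} {v} e with col u Fin.≟ col v
    ... | yes c = f-inj (col v) (trans (cong (λ i → f i u) (sym c)) e)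
    ... | no ¬c = contradiction (subst (_~ emb v) e (emb-adj u v ¬c)) ~-irrefl

  free⇒few-cliques : ∀ E → (size G ^ s < E * sumL s (λ t → ind (isK t)) → Box isK s (size H)) →
    (H -free) G → E * sumL s (λ t → ind (isK t)) ≤ size G ^ s
  free⇒few-cliques E find free = ≮⇒≥ λ dense → free (Box⇒ContainsSub (find dense))

degree+nonDegree : ∀ G v → degree G v + sumFin (λ w → ind (not (adj G v w))) ≡ size G
degree+nonDegree G v = begin
  degree G v + sumFin (λ w → ind (not (adj G v w)))
    ≡⟨ cong (_+ sumFin (λ w → ind (not (adj G v w)))) (count≡sum (adj G v)) ⟩
  sumFin (λ w → ind (adj G v w)) + sumFin (λ w → ind (not (adj G v w)))
    ≡⟨ sum-+ (λ w → ind (adj G v w)) (λ w → ind (not (adj G v w))) ⟨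
  sumFin (λ w → ind (adj G v w) + ind (not (adj G v w)))
    ≡⟨ sum-cong (λ w → one (adj G v w)) ⟩
  sumFin {size G} (λ _ → 1)
    ≡⟨ trans (sum-const (size G) 1) (*-identityʳ _) ⟩
  size G ∎
  where
  open ≡-Reasoning
  one : ∀ b → ind b + ind (not b) ≡ 1
  one true  = refl
  one false = refl

partition⇒ApproxPartite : ∀ G → IsSimple G → ∀ r η e → 1ℚ ℚ.≤ ℕ→ℚ e ℚ.* η → 0ℚ ℚ.< η →
  (class : Fin (size G) → Fin r) →
  e * sumFin (λ x → sumFin (λ y → ind (adj G x y ∧ ⌊ class x Fin.≟ class y ⌋))) ≤ size G * size G →
  ApproxPartite G r η
partition⇒ApproxPartite G simple r η e 1≤ η>0 class bound =
  a′ , simple′ , sub , (class , λ u v h → proj₂ (∧⁻ (adj G u v) _ h)) ,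
  η-upper η e _ (size G) 1≤ η>0 (≤-trans (*-monoʳ-≤ e
    (≤-trans edges-lost≤ (sum-mono λ u → sum-mono λ v → ind-mono (lost⇒ (adj G u v) ⌊ class u Fin.≟ class v ⌋)))) bound)
  where
  a′ : Fin (size G) → Fin (size G) → Bool
  a′ u v = adj G u v ∧ not ⌊ class u Fin.≟ class v ⌋
  ≟-sym : ∀ {m} (i j : Fin m) → ⌊ i Fin.≟ j ⌋ ≡ ⌊ j Fin.≟ i ⌋
  ≟-sym i j with i Fin.≟ j | j Fin.≟ i
  ... | yes _ | yes _ = refl
  ... | no _  | no _  = refl
  ... | yes e | no ¬e = contradiction (sym e) ¬e
  ... | no ¬e | yes e = contradiction (sym e) ¬e
  simple′ : IsSimple (withAdj G a′)
  simple′ = (λ u v → cong₂ (λ a b → a ∧ not b) (proj₁ simple u v) (≟-sym (class u) (class v)))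
          , λ u → cong (_∧ not ⌊ class u Fin.≟ class u ⌋) (proj₂ simple u)
  sub : ∀ u v → a′ u v ≡ true → adj G u v ≡ true
  sub u v h = proj₁ (∧⁻ (adj G u v) _ h)
  lost⇒ : ∀ a b → a ∧ not (a ∧ not b) ≡ true → a ∧ b ≡ true
  lost⇒ true true _ = refl
  open LostEdges G simple a′ simple′ sub

upper-bound : ∀ H r → Hom H (K (3 + r)) → δ≤ H (2 + r) (1ℚ ℚ.- inv (ℕ→ℚ (2 + r) ℚ.- inv (ℕ→ℚ 3)))
upper-bound H r χ d U<d η η>0 = setup (3 * r + 5) refl (>-nonZero (≤-trans (s≤s z≤n) (m≤n+m 5 (3 * r))))
  where
  upper : ∀ ρ → ρ ≡ 3 * r + 5 → ∀ q →
    (∀ d′ m → d ℚ.* ℕ→ℚ (d′ + m) ℚ.≤ ℕ→ℚ d′ → q * ρ * m + (d′ + m) ≤ 3 * q * (d′ + m)) →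
    ∀ e → 1ℚ ℚ.≤ ℕ→ℚ e ℚ.* η → ∀ c → c ≡ (2 + r) * (3 * ρ * q) → NonZero c →
    ∃ λ n₀ → ∀ (G : Graph) → IsSimple G → n₀ ≤ size G → (H -free) G →
      (∀ v → d ℚ.* ℕ→ℚ (size G) ℚ.≤ ℕ→ℚ (degree G v)) → ApproxPartite G (2 + r) η
  -- The `suc` guarantees a nonempty graph, needed to cancel powers of n.
  upper ρ ρ≡ q dense e 1≤ c c≡ c≢0 = suc (proj₁ found) , conclude
    where
    depth N E : ℕ
    depth = suc r + (suc r + suc r)
    N = depth + (4 + r)
    -- The factors are the losses in counting (r+2)-cliques, in the `depth` forced steps, and in
    -- locating K_{r+3} within an N-tuple.
    E = e * c ^ (2 + r) * (c ^ depth * 2 ^ N)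
    found = box (3 + r) (size H) E
    conclude : ∀ (G : Graph) → IsSimple G → suc (proj₁ found) ≤ size G → (H -free) G →
      (∀ v → d ℚ.* ℕ→ℚ (size G) ℚ.≤ ℕ→ℚ (degree G v)) → ApproxPartite G (2 + r) η
    conclude G simple n≥ free deg = partition⇒ApproxPartite G simple (2 + r) η e 1≤ η>0 (proj₁ class) (proj₂ class)
      where
      few : ∀ v → q * ρ * sumFin (λ w → ind (not (adj G v w))) + size G ≤ 3 * q * size G
      few v = subst (λ n → q * ρ * sumFin (λ w → ind (not (adj G v w))) + n ≤ 3 * q * n) (degree+nonDegree G v)
        (dense (degree G v) (sumFin (λ w → ind (not (adj G v w))))
          (subst (λ n → d ℚ.* ℕ→ℚ n ℚ.≤ ℕ→ℚ (degree G v)) (sym (degree+nonDegree G v)) (deg v)))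
      open Cliques G simple using (isK)
      class : Σ (Fin (size G) → Fin (2 + r)) λ class →
        e * sumFin (λ x → sumFin (λ y → ind (adj G x y ∧ ⌊ class x Fin.≟ class y ⌋))) ≤ size G * size G
      class = Dense.few-cliques⇒partition G simple r q ρ c ρ≡ c≡ {{c≢0}} few e N refl (≤-trans (s≤s z≤n) n≥)
        (free⇒few-cliques H (3 + r) χ G simple E (proj₂ found (size G) (≤-trans (n≤1+n _) n≥) isK) free)
  setup : ∀ ρ → ρ ≡ 3 * r + 5 → NonZero ρ → ∃ λ n₀ → ∀ (G : Graph) → IsSimple G → n₀ ≤ size G → (H -free) G →
    (∀ v → d ℚ.* ℕ→ℚ (size G) ℚ.≤ ℕ→ℚ (degree G v)) → ApproxPartite G (2 + r) η
  setup ρ ρ≡ ρ≢0 =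
    let q , q≢0 , dense = degree-upper d ρ {{ρ≢0}} (subst (λ u → 1ℚ ℚ.- u ℚ.< d) (inv-upper r ρ {{ρ≢0}} ρ≡) U<d)
        e , _ , 1≤ = archimedes η η>0
    in upper ρ ρ≡ q dense e 1≤ ((2 + r) * (3 * ρ * q)) refl
         (m*n≢0 (2 + r) (3 * ρ * q) {{_}} {{m*n≢0 (3 * ρ) q {{m*n≢0 3 ρ {{_}} {{ρ≢0}}}} {{q≢0}}}})

-- The lower bound

joinAdj : (G F : Graph) → Fin (size G) ⊎ Fin (size F) → Fin (size G) ⊎ Fin (size F) → Bool
joinAdj G F (inj₁ x) (inj₁ y) = adj G x y
joinAdj G F (inj₂ x) (inj₂ y) = adj F x y
joinAdj G F (inj₁ _) (inj₂ _) = true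
joinAdj G F (inj₂ _) (inj₁ _) = true

⊕-adj : ∀ G F u v → adj (G ⊕ F) u v ≡ joinAdj G F (splitAt (size G) u) (splitAt (size G) v)
⊕-adj G F u v with splitAt (size G) u | splitAt (size G) v
... | inj₁ _ | inj₁ _ = refl
... | inj₂ _ | inj₂ _ = refl
... | inj₁ _ | inj₂ _ = refl
... | inj₂ _ | inj₁ _ = refl

⊕-simple : ∀ G F → IsSimple G → IsSimple F → IsSimple (G ⊕ F)
⊕-simple G F (sG , iG) (sF , iF) =
  (λ u v → trans (⊕-adj G F u v) (trans (symm (splitAt _ u) (splitAt _ v)) (sym (⊕-adj G F v u)))) ,
  (λ u → trans (⊕-adj G F u u) (irr (splitAt _ u)))
  where
  symm : ∀ s t → joinAdj G F s t ≡ joinAdj G F t s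
  symm (inj₁ x) (inj₁ y) = sG x y
  symm (inj₂ x) (inj₂ y) = sF x y
  symm (inj₁ _) (inj₂ _) = refl
  symm (inj₂ _) (inj₁ _) = refl
  irr : ∀ s → joinAdj G F s s ≡ false
  irr (inj₁ x) = iG x
  irr (inj₂ x) = iF x

K-simple : ∀ m → IsSimple (K m)
K-simple m = symm , irr
  where
  symm : ∀ u v → adj (K m) u v ≡ adj (K m) v u
  symm u v with u Fin.≟ v | v Fin.≟ u
  ... | yes _ | yes _ = refl
  ... | no _  | no _  = refl
  ... | yes e | no ¬e = contradiction (sym e) ¬e
  ... | no ¬e | yes e = contradiction (sym e) ¬e
  irr : ∀ u → adj (K m) u u ≡ false
  irr u with u Fin.≟ u
  ... | yes _ = refl
  ... | no ¬e = contradiction refl ¬e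

Step : ∀ {k} → Fin (suc k) → Fin (suc k) → Set
Step {k} u v = toℕ v ≡ suc (toℕ u) ⊎ (toℕ u ≡ k × toℕ v ≡ 0)

step⁺ : ∀ {k} (u v : Fin (suc k)) → Step u v → stepC (suc k) u v ≡ true
step⁺ {k} u v (inj₁ e) = ⌊⌋⁺ (_ Data.Nat.≟ _)
  (trans (m<n⇒m%n≡m (subst (_< suc k) e (toℕ<n v))) (sym e))
step⁺ {k} u v (inj₂ (e , z)) = ⌊⌋⁺ (_ Data.Nat.≟ _)
  (trans (cong (λ i → suc i % suc k) e) (trans (n%n≡0 (suc k)) (sym z)))

step⁻ : ∀ {k} (u v : Fin (suc k)) → stepC (suc k) u v ≡ true → Step u v
step⁻ {k} u v h with suc (toℕ u) <? suc k
... | yes p = inj₁ (trans (sym (⌊⌋⁻ (_ Data.Nat.≟ _) h)) (m<n⇒m%n≡m p))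
... | no ¬p = inj₂ (u≡k , trans (sym (⌊⌋⁻ (_ Data.Nat.≟ _) h)) (trans (cong (λ i → suc i % suc k) u≡k) (n%n≡0 (suc k))))
  where
  u≡k : toℕ u ≡ k
  u≡k = suc-injective (≤-antisym (toℕ<n u) (≮⇒≥ ¬p))

C-adj⁺ : ∀ {k} (u v : Fin (suc k)) → Step u v ⊎ Step v u → adj (C (suc k)) u v ≡ true
C-adj⁺ u v (inj₁ s) = ∨⁺ˡ (step⁺ u v s)
C-adj⁺ u v (inj₂ s) = ∨⁺ʳ (stepC _ u v) (step⁺ v u s)

C-adj⁻ : ∀ {k} (u v : Fin (suc k)) → adj (C (suc k)) u v ≡ true → Step u v ⊎ Step v u
C-adj⁻ u v h with ∨⁻ (stepC _ u v) _ h
... | inj₁ s = inj₁ (step⁻ u v s)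
... | inj₂ s = inj₂ (step⁻ v u s)

C-simple : ∀ k → 1 ≤ k → IsSimple (C (suc k))
C-simple k k≥1 = (λ u v → ∨-comm (stepC (suc k) u v) (stepC (suc k) v u)) , irr
  where
  ¬loop : ∀ (u : Fin (suc k)) → ¬ Step u u
  ¬loop u (inj₁ e)       = 1+n≢n (sym e)
  ¬loop u (inj₂ (e , z)) = contradiction (subst (1 ≤_) (trans (sym e) z) k≥1) λ ()
  irr : ∀ u → adj (C (suc k)) u u ≡ false
  irr u with adj (C (suc k)) u u in eq
  ... | false = refl
  ... | true with C-adj⁻ u u eq
  ... | inj₁ s = contradiction s (¬loop u)
  ... | inj₂ s = contradiction s (¬loop u)

-- `2 ≤ k` keeps predecessor and successor distinct; the wrap-around at both ends of the cycle
-- causes the cases.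
C-degree : ∀ k → 2 ≤ k → ∀ y → 2 ≤ sumFin (λ j → ind (adj (C (suc k)) y j))
C-degree k k≥2 y = let a , b , a≢b , ya , yb = neighbours (toℕ y) refl in two a b a≢b ya yb
  where
  two : ∀ a b → a ≢ b → adj (C (suc k)) y a ≡ true → adj (C (suc k)) y b ≡ true →
    2 ≤ sumFin (λ j → ind (adj (C (suc k)) y j))
  two a b a≢b ya yb = begin
    2                                                  ≡⟨ cong₂ _+_ (sum-δ (λ _ → 1) a) (sum-δ (λ _ → 1) b) ⟨
    sumFin (λ j → 1 * δ= a j) + sumFin (λ j → 1 * δ= b j) ≡⟨ sum-+ (λ j → 1 * δ= a j) (λ j → 1 * δ= b j) ⟨
    sumFin (λ j → 1 * δ= a j + 1 * δ= b j)             ≤⟨ sum-mono pointwise ⟩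
    sumFin (λ j → ind (adj (C (suc k)) y j))           ∎
    where
    open ≤-Reasoning
    pointwise : ∀ j → 1 * δ= a j + 1 * δ= b j ≤ ind (adj (C (suc k)) y j)
    pointwise j with a Fin.≟ j | b Fin.≟ j
    ... | yes refl | yes refl = contradiction refl a≢b
    ... | yes refl | no _     = ≤-reflexive (cong ind (sym ya))
    ... | no _     | yes refl = ≤-reflexive (cong ind (sym yb))
    ... | no _     | no _     = z≤n
  neighbours : ∀ t → toℕ y ≡ t → ∃ λ a → ∃ λ b → a ≢ b × adj (C (suc k)) y a ≡ true × adj (C (suc k)) y b ≡ true
  neighbours zero eq = a , b , a≢b , C-adj⁺ y a (inj₂ (inj₂ (toℕ-fromℕ< k<1+k , eq)))
             , C-adj⁺ y b (inj₁ (inj₁ (trans (toℕ-fromℕ< 1<1+k) (cong suc (sym eq)))))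
    where
    k<1+k : k < suc k
    k<1+k = ≤-refl
    1<1+k : 1 < suc k
    1<1+k = s≤s (≤-trans (s≤s z≤n) k≥2)
    a b : Fin (suc k)
    a = fromℕ< k<1+k
    b = fromℕ< 1<1+k
    a≢b : a ≢ b
    a≢b e = contradiction (subst (2 ≤_) (trans (sym (toℕ-fromℕ< k<1+k)) (trans (cong toℕ e) (toℕ-fromℕ< 1<1+k))) k≥2) λ { (s≤s ()) }
  neighbours (suc t) eq = next (suc t Data.Nat.≟ k)
    where
    t<1+k : t < suc k
    t<1+k = ≤-trans (n≤1+n _) (subst (_< suc k) eq (toℕ<n y))
    a : Fin (suc k)
    a = fromℕ< t<1+k
    ya : adj (C (suc k)) y a ≡ true
    ya = C-adj⁺ y a (inj₂ (inj₁ (trans eq (cong suc (sym (toℕ-fromℕ< t<1+k))))))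
    next : Dec (suc t ≡ k) → ∃ λ a → ∃ λ b → a ≢ b × adj (C (suc k)) y a ≡ true × adj (C (suc k)) y b ≡ true
    next (yes e) = a , zero , a≢0 , ya , C-adj⁺ y zero (inj₁ (inj₂ (trans eq e , refl)))
      where
      a≢0 : a ≢ zero
      a≢0 h = contradiction (subst (2 ≤_) (trans (sym e) (cong suc (trans (sym (toℕ-fromℕ< t<1+k)) (cong toℕ h)))) k≥2) λ { (s≤s ()) }
    next (no ¬e) = a , b , a≢b , ya , C-adj⁺ y b (inj₁ (inj₁ (trans (toℕ-fromℕ< b<) (cong suc (sym eq)))))
      where
      b< : suc (suc t) < suc k
      b< = s≤s (≤∧≢⇒< (s≤s⁻¹ (subst (_< suc k) eq (toℕ<n y))) ¬e)
      b : Fin (suc k)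
      b = fromℕ< b<
      a≢b : a ≢ b
      a≢b h = contradiction (trans (sym (toℕ-fromℕ< t<1+k)) (trans (cong toℕ h) (toℕ-fromℕ< b<))) (m≢1+m+n t {1} ∘ λ e → trans e (cong suc (+-comm 1 t)))

module OddWheel (r g : ℕ) (f : Hom (K r ⊕ C (suc (g + g))) (K (2 + r))) where
  private
    k : ℕ
    k = g + g
    cK : Fin r → Fin (2 + r)
    cK i = proj₁ f (i ↑ˡ suc k)
    cC : Fin (suc k) → Fin (2 + r)
    cC j = proj₁ f (r ↑ʳ j)
    KK : ∀ i j → i ≢ j → cK i ≢ cK j
    KK i j ne = K-adj⁻ (proj₂ f _ _ (trans (⊕-adj (K r) (C (suc k)) (i ↑ˡ suc k) (j ↑ˡ suc k))
      (trans (cong₂ (joinAdj (K r) (C (suc k))) (splitAt-↑ˡ r i (suc k)) (splitAt-↑ˡ r j (suc k))) (K-adj⁺ ne))))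
    KC : ∀ i j → cK i ≢ cC j
    KC i j = K-adj⁻ (proj₂ f _ _ (trans (⊕-adj (K r) (C (suc k)) (i ↑ˡ suc k) (r ↑ʳ j))
      (cong₂ (joinAdj (K r) (C (suc k))) (splitAt-↑ˡ r i (suc k)) (splitAt-↑ʳ r (suc k) j))))
    CC : ∀ i j → Step i j → cC i ≢ cC j
    CC i j s = K-adj⁻ (proj₂ f _ _ (trans (⊕-adj (K r) (C (suc k)) (r ↑ʳ i) (r ↑ʳ j))
      (trans (cong₂ (joinAdj (K r) (C (suc k))) (splitAt-↑ʳ r (suc k) i) (splitAt-↑ʳ r (suc k) j)) (C-adj⁺ i j (inj₁ s)))))

    -- Otherwise K_r and three consecutive cycle vertices would use r + 3 colours.
    two-steps : ∀ i j l → Step i j → Step j l → cC l ≡ cC i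
    two-steps i j l ij jl with cC l Fin.≟ cC i
    ... | yes e = e
    ... | no li = contradiction (trans (sym (join-splitAt r 3 x)) (trans (cong (join r 3) same) (join-splitAt r 3 y)))
                    (λ e → <⇒≢ x<y (cong toℕ e))
      where
      tri : Fin 3 → Fin (2 + r)
      tri zero             = cC i
      tri (suc zero)       = cC j
      tri (suc (suc zero)) = cC l
      col : Fin r ⊎ Fin 3 → Fin (2 + r)
      col (inj₁ a) = cK a
      col (inj₂ b) = tri b
      K-tri : ∀ a b → cK a ≢ tri b
      K-tri a zero             = KC a i
      K-tri a (suc zero)       = KC a j
      K-tri a (suc (suc zero)) = KC a l
      tri-inj : ∀ a b → tri a ≡ tri b → a ≡ b
      tri-inj zero zero e = refl
      tri-inj zero (suc zero) e = contradiction e (CC i j ij)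
      tri-inj zero (suc (suc zero)) e = contradiction (sym e) li
      tri-inj (suc zero) zero e = contradiction (sym e) (CC i j ij)
      tri-inj (suc zero) (suc zero) e = refl
      tri-inj (suc zero) (suc (suc zero)) e = contradiction e (CC j l jl)
      tri-inj (suc (suc zero)) zero e = contradiction e li
      tri-inj (suc (suc zero)) (suc zero) e = contradiction (sym e) (CC j l jl)
      tri-inj (suc (suc zero)) (suc (suc zero)) e = refl
      col-inj : ∀ s t → col s ≡ col t → s ≡ t
      col-inj (inj₁ a) (inj₁ b) e with a Fin.≟ b
      ... | yes a≡b = cong inj₁ a≡b
      ... | no  a≢b = contradiction e (KK a b a≢b)
      col-inj (inj₁ a) (inj₂ b) e = contradiction e (K-tri a b)
      col-inj (inj₂ a) (inj₁ b) e = contradiction (sym e) (K-tri b a)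
      col-inj (inj₂ a) (inj₂ b) e = cong inj₂ (tri-inj a b e)
      clash : ∃ λ x → ∃ λ y → x Fin.< y × col (splitAt r x) ≡ col (splitAt r y)
      clash = pigeonhole (subst (2 + r <_) (+-comm 3 r) ≤-refl) (λ x → col (splitAt r x))
      x y : Fin (r + 3)
      x = proj₁ clash
      y = proj₁ (proj₂ clash)
      x<y : x Fin.< y
      x<y = proj₁ (proj₂ (proj₂ clash))
      same : splitAt r x ≡ splitAt r y
      same = col-inj _ _ (proj₂ (proj₂ (proj₂ clash)))

    -- All even positions share one colour. Position 2g is among them although it is adjacent to
    -- position 0, which gives the contradiction.
    even : ∀ t (l : Fin (suc k)) → toℕ l ≡ t + t → cC l ≡ cC zero
    even zero    l e = cong cC (toℕ-injective e)
    even (suc t) l e = trans (two-steps i j l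
        (inj₁ (trans (toℕ-fromℕ< j<) (cong suc (sym (toℕ-fromℕ< i<)))))
        (inj₁ (trans e′ (cong suc (sym (toℕ-fromℕ< j<))))))
      (even t i (toℕ-fromℕ< i<))
      where
      e′ : toℕ l ≡ suc (suc (t + t))
      e′ = trans e (cong suc (+-suc t t))
      j< : suc (t + t) < suc k
      j< = ≤-trans (n≤1+n _) (subst (_< suc k) e′ (toℕ<n l))
      i< : t + t < suc k
      i< = ≤-trans (n≤1+n _) j<
      i j : Fin (suc k)
      i = fromℕ< i<
      j = fromℕ< j<

  absurd : ⊥
  absurd = CC last zero (inj₂ (toℕ-fromℕ< ≤-refl , refl)) (even g last (toℕ-fromℕ< ≤-refl))
    where
    last : Fin (suc k)
    last = fromℕ< {k} ≤-refl

-- Weighted blow-ups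

fibre : ∀ {f} (w : Fin f → ℕ) → Fin (sumFin w) → Fin f
fibre {suc f} w u with splitAt (w zero) u
... | inj₁ _ = zero
... | inj₂ v = suc (fibre (w ∘ suc) v)

sum-fibre : ∀ {f} (w g : Fin f → ℕ) → sumFin (λ u → g (fibre w u)) ≡ sumFin (λ i → w i * g i)
sum-fibre {zero}  w g = refl
sum-fibre {suc f} w g = begin
  sumFin (λ u → g (fibre w u))
    ≡⟨ sum-split (w zero) (sumFin (w ∘ suc)) (λ u → g (fibre w u)) ⟩
  sumFin (λ i → g (fibre w (i ↑ˡ sumFin (w ∘ suc)))) + sumFin (λ j → g (fibre w (w zero ↑ʳ j)))
    ≡⟨ cong₂ _+_ (trans (sum-cong λ i → cong g (left i)) (sum-const (w zero) (g zero)))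
                 (trans (sum-cong λ j → cong g (right j)) (sum-fibre (w ∘ suc) (g ∘ suc))) ⟩
  w zero * g zero + sumFin (λ i → w (suc i) * g (suc i)) ∎
  where
  open ≡-Reasoning
  left : ∀ i → fibre w (i ↑ˡ sumFin (w ∘ suc)) ≡ zero
  left i rewrite splitAt-↑ˡ (w zero) i (sumFin (w ∘ suc)) = refl
  right : ∀ j → fibre w (w zero ↑ʳ j) ≡ suc (fibre (w ∘ suc) j)
  right j rewrite splitAt-↑ʳ (w zero) (sumFin (w ∘ suc)) j = refl

blowUp : (F : Graph) → (Fin (size F) → ℕ) → Graph
blowUp F w = record { size = sumFin w ; adj = λ u v → adj F (fibre w u) (fibre w v) }

module BlowUp (F : Graph) (simple : IsSimple F) (w : Fin (size F) → ℕ) where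

  private
    G : Graph
    G = blowUp F w
    π : Fin (size G) → Fin (size F)
    π = fibre w

  blowUp-simple : IsSimple G
  blowUp-simple = (λ u v → proj₁ simple (π u) (π v)) , λ u → proj₂ simple (π u)

  -- A copy of `H` followed by the projection is a homomorphism to `F`.
  blowUp-free : ∀ H → ¬ Hom H F → (H -free) G
  blowUp-free H ¬hom (f , _ , edge) = ¬hom (π ∘ f , edge)

  blowUp-degree : ∀ u → degree G u ≡ sumFin (λ i → w i * ind (adj F (π u) i))
  blowUp-degree u = trans (count≡sum (adj G u)) (sum-fibre w (λ i → ind (adj F (π u) i)))

  -- Colour each vertex of F by the most frequent colour on its fibre: some edge of F becomes monochromatic.
  blowUp-far : ∀ r T → ¬ Hom F (K (suc r)) → (∀ i → T ≤ w i) →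
    (a′ : Fin (size G) → Fin (size G) → Bool) → let G′ = withAdj G a′ in
    IsSimple G′ → (∀ u v → a′ u v ≡ true → adj G u v ≡ true) → Hom G′ (K (suc r)) →
    T * T ≤ suc r * suc r * (2 * (edges G ∸ edges G′))
  blowUp-far r T ¬col T≤ a′ simple′ sub (c , proper) = ≮⇒≥ λ few → ¬col (χ , λ i j ij → K-adj⁺ λ e → <⇒≱ few (many i j ij e))
    where
    open LostEdges G blowUp-simple a′ simple′ sub
    open ≤-Reasoning
    R : ℕ
    R = suc r
    cnt : Fin (size F) → Fin R → ℕ
    cnt i k = sumFin λ u → δ= i (π u) * δ= (c u) k
    cnt-total : ∀ i → sumFin (cnt i) ≡ w i
    cnt-total i = begin-equality
      sumFin (λ k → sumFin λ u → δ= i (π u) * δ= (c u) k)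
        ≡⟨ sum-swap (λ k u → δ= i (π u) * δ= (c u) k) ⟩
      sumFin (λ u → sumFin λ k → δ= i (π u) * δ= (c u) k)
        ≡⟨ sum-cong (λ u → sum-δ (λ _ → δ= i (π u)) (c u)) ⟩
      sumFin (λ u → δ= i (π u))
        ≡⟨ sum-fibre w (δ= i) ⟩
      sumFin (λ j → w j * δ= i j)
        ≡⟨ sum-δ w i ⟩
      w i ∎
    majority : ∀ i → ∃ λ k → sumFin (cnt i) ≤ R * cnt i k
    majority i = sum≤max (cnt i) zero
    χ : Fin (size F) → Fin R
    χ i = proj₁ (majority i)
    large : ∀ i → T ≤ R * cnt i (χ i)
    large i = ≤-trans (T≤ i) (≤-trans (≤-reflexive (sym (cnt-total i))) (proj₂ (majority i)))
    -- If the majority colours of the adjacent vertices i and j agree, every pair of majority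
    -- vertices of the two fibres is a lost edge. Each majority costs a factor `R`; the 2 comes from
    -- counting ordered pairs.
    many : ∀ i j → adj F i j ≡ true → χ i ≡ χ j → T * T ≤ R * R * (2 * (edges G ∸ edges (withAdj G a′)))
    many i j ij e = begin
      T * T
        ≤⟨ *-mono-≤ (large i) (large j) ⟩
      (R * cnt i k) * (R * cnt j (χ j))
        ≡⟨ cong (λ l → (R * cnt i k) * (R * cnt j l)) (sym e) ⟩
      (R * cnt i k) * (R * cnt j k)
        ≡⟨ regroup R (cnt i k) (cnt j k) ⟩
      R * R * (cnt j k * cnt i k)
        ≡⟨ cong (R * R *_) (sum-* (cnt j k) (λ u → δ= i (π u) * δ= (c u) k)) ⟨
      R * R * sumFin (λ u → cnt j k * (δ= i (π u) * δ= (c u) k))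
        ≡⟨ cong (R * R *_) (sum-cong λ u → trans (*-comm (cnt j k) _) (sym (sum-* (δ= i (π u) * δ= (c u) k) (λ v → δ= j (π v) * δ= (c v) k)))) ⟩
      R * R * sumFin (λ u → sumFin λ v → (δ= i (π u) * δ= (c u) k) * (δ= j (π v) * δ= (c v) k))
        ≤⟨ *-monoʳ-≤ (R * R) (sum-mono λ u → sum-mono λ v → pointwise u v) ⟩
      R * R * sumFin (λ u → sumFin λ v → ind (lostEdge G a′ u v))
        ≤⟨ *-monoʳ-≤ (R * R) lost≤edges-lost ⟩
      R * R * (2 * (edges G ∸ edges (withAdj G a′))) ∎
      where
      k : Fin R
      k = χ i
      regroup : ∀ a b d → (a * b) * (a * d) ≡ a * a * (d * b)
      regroup = solve-∀
      pointwise : ∀ u v → (δ= i (π u) * δ= (c u) k) * (δ= j (π v) * δ= (c v) k) ≤ ind (lostEdge G a′ u v)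
      pointwise u v with i Fin.≟ π u | c u Fin.≟ k | j Fin.≟ π v | c v Fin.≟ k
      ... | no _  | _     | _     | _     = z≤n
      ... | yes _ | no _  | _     | _     = z≤n
      ... | yes _ | yes _ | no _  | _     = z≤n
      ... | yes _ | yes _ | yes _ | no _  = z≤n
      ... | yes p | yes q | yes p′ | yes q′ = ≤-reflexive (cong ind (sym (lost (a′ u v) refl)))
        where
        lost : ∀ b → a′ u v ≡ b → adj G u v ∧ not b ≡ true
        lost true  eq = contradiction (trans q (sym q′)) (K-adj⁻ (proper u v eq))
        lost false eq = cong (_∧ true) (subst₂ (λ x y → adj F x y ≡ true) p p′ ij)

module LowerBound (r g : ℕ) (g≥1 : 1 ≤ g) (T m : ℕ) (m≡ : suc m ≡ g + g) where

  private
    k : ℕ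
    k = suc m
    k≥2 : 2 ≤ k
    k≥2 = ≤-trans (+-mono-≤ g≥1 g≥1) (≤-reflexive (sym m≡))

  F : Graph
  F = K r ⊕ C (suc k)

  -- These weights equalise the numbers of non-neighbours, with m = 2g - 1: a clique vertex misses
  -- its own fibre of size `T * m`, a cycle vertex misses 2g + 1 - 2 = m fibres of size `T`.
  weight : Fin r ⊎ Fin (suc k) → ℕ
  weight (inj₁ _) = T * m
  weight (inj₂ _) = T

  w : Fin (size F) → ℕ
  w i = weight (splitAt r i)

  F-simple : IsSimple F
  F-simple = ⊕-simple (K r) (C (suc k)) (K-simple r) (C-simple k (≤-trans (n≤1+n 1) k≥2))

  F-uncolourable : ¬ Hom F (K (2 + r))
  F-uncolourable = uncolourable k m≡
    where
    uncolourable : ∀ k → k ≡ g + g → ¬ Hom (K r ⊕ C (suc k)) (K (2 + r))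
    uncolourable _ refl = OddWheel.absurd r g

  sum-weighted : ∀ (h : Fin r ⊎ Fin (suc k) → ℕ) → sumFin (λ i → w i * h (splitAt r i)) ≡
    T * m * sumFin (λ i → h (inj₁ i)) + T * sumFin (λ j → h (inj₂ j))
  sum-weighted h = trans (sum-split r (suc k) (λ i → w i * h (splitAt r i)))
    (cong₂ _+_ (trans (sum-cong λ i → cong (λ s → weight s * h s) (splitAt-↑ˡ r i (suc k))) (sum-* (T * m) (h ∘ inj₁)))
               (trans (sum-cong λ j → cong (λ s → weight s * h s) (splitAt-↑ʳ r (suc k) j)) (sum-* T (h ∘ inj₂))))

  size≡ : sumFin w ≡ T * (suc r * m + 2)
  size≡ = begin
    sumFin w                                   ≡⟨ sum-cong (λ i → sym (*-identityʳ (w i))) ⟩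
    sumFin (λ i → w i * 1)                     ≡⟨ sum-weighted (λ _ → 1) ⟩
    T * m * sumFin {r} (λ _ → 1) + T * sumFin {suc k} (λ _ → 1)
      ≡⟨ cong₂ (λ a b → T * m * a + T * b) (sum-const r 1) (sum-const (suc k) 1) ⟩
    T * m * (r * 1) + T * ((2 + m) * 1)        ≡⟨ collect T m r ⟩
    T * (suc r * m + 2)                        ∎
    where
    open ≡-Reasoning
    collect : ∀ T m r → T * m * (r * 1) + T * ((2 + m) * 1) ≡ T * (suc r * m + 2)
    collect = solve-∀

  open BlowUp F F-simple w

  degree≥ : ∀ u → T * (suc r * m + 2) ≤ degree (blowUp F w) u + T * m
  degree≥ u = ≤-trans (bound (splitAt r (fibre w u))) (≤-reflexive (cong (_+ T * m) (sym deg)))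
    where
    open ≤-Reasoning
    J = joinAdj (K r) (C (suc k))
    deg : degree (blowUp F w) u ≡ T * m * sumFin (λ i → ind (J (splitAt r (fibre w u)) (inj₁ i))) +
                                  T * sumFin (λ j → ind (J (splitAt r (fibre w u)) (inj₂ j)))
    deg = trans (blowUp-degree u) (trans (sum-cong λ i → cong (λ b → w i * ind b) (⊕-adj (K r) (C (suc k)) (fibre w u) i))
      (sum-weighted (λ s → ind (J (splitAt r (fibre w u)) s))))
    bound : ∀ s → T * (suc r * m + 2) ≤
      T * m * sumFin (λ i → ind (J s (inj₁ i))) + T * sumFin (λ j → ind (J s (inj₂ j))) + T * m
    bound (inj₁ x) = begin
      T * (suc r * m + 2)
        ≡⟨ collect T m r ⟩
      T * m * r + T * (2 + m)
        ≤⟨ +-mono-≤ (*-monoʳ-≤ (T * m) r≤) (≤-reflexive (cong (T *_) (sym (trans (sum-const (suc k) 1) (*-identityʳ _))))) ⟩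
      T * m * (sumFin (λ i → ind (adj (K r) x i)) + 1) + T * sumFin {suc k} (λ _ → 1)
        ≡⟨ regroup (T * m) (sumFin (λ i → ind (adj (K r) x i))) _ ⟩
      T * m * sumFin (λ i → ind (adj (K r) x i)) + T * sumFin {suc k} (λ _ → 1) + T * m ∎
      where
      collect : ∀ T m r → T * (suc r * m + 2) ≡ T * m * r + T * (2 + m)
      collect = solve-∀
      regroup : ∀ a s b → a * (s + 1) + b ≡ a * s + b + a
      regroup = solve-∀
      one : ∀ i → 1 ≤ ind (adj (K r) x i) + 1 * δ= x i
      one i with x Fin.≟ i
      ... | yes _ = ≤-refl
      ... | no  _ = ≤-refl
      r≤ : r ≤ sumFin (λ i → ind (adj (K r) x i)) + 1
      r≤ = begin
        r                                                        ≡⟨ trans (sum-const r 1) (*-identityʳ r) ⟨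
        sumFin {r} (λ _ → 1)                                     ≤⟨ sum-mono one ⟩
        sumFin (λ i → ind (adj (K r) x i) + 1 * δ= x i)          ≡⟨ sum-+ (λ i → ind (adj (K r) x i)) (λ i → 1 * δ= x i) ⟩
        sumFin (λ i → ind (adj (K r) x i)) + sumFin (λ i → 1 * δ= x i) ≡⟨ cong (sumFin (λ i → ind (adj (K r) x i)) +_) (sum-δ (λ _ → 1) x) ⟩
        sumFin (λ i → ind (adj (K r) x i)) + 1                   ∎
    bound (inj₂ y) = begin
      T * (suc r * m + 2)
        ≡⟨ collect T m r ⟩
      T * m * r + T * 2 + T * m
        ≤⟨ +-monoˡ-≤ (T * m) (+-mono-≤ (≤-reflexive (cong (T * m *_) (sym (trans (sum-const r 1) (*-identityʳ r)))))
                                       (*-monoʳ-≤ T (C-degree k k≥2 y))) ⟩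
      T * m * sumFin {r} (λ _ → 1) + T * sumFin (λ j → ind (adj (C (suc k)) y j)) + T * m ∎
      where
      collect : ∀ T m r → T * (suc r * m + 2) ≡ T * m * r + T * 2 + T * m
      collect = solve-∀

  weight≥T : 1 ≤ m → ∀ i → T ≤ w i
  weight≥T m≥1 i with splitAt r i
  ... | inj₁ _ = m≤m*n T m {{>-nonZero m≥1}}
  ... | inj₂ _ = ≤-refl

-- The constant 4 is chosen so that the two estimates of d differ by a factor 2.
far-arith : ∀ T N R d → 1 ≤ T → 1 ≤ N → 4 * (R * R) * (N * N) * d ≤ (T * N) * (T * N) → T * T ≤ R * R * (2 * d) → ⊥
far-arith T N R d T≥1 N≥1 few many = <⇒≱ (m<m+n X (*-mono-≤ (*-mono-≤ T≥1 N≥1) (*-mono-≤ T≥1 N≥1))) (begin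
  X + X                              ≡⟨ e₁ T N ⟩
  2 * (N * N) * (T * T)              ≤⟨ *-monoʳ-≤ (2 * (N * N)) many ⟩
  2 * (N * N) * (R * R * (2 * d))    ≡⟨ e₂ N R d ⟩
  4 * (R * R) * (N * N) * d          ≤⟨ few ⟩
  X                                  ∎)
  where
  open ≤-Reasoning
  X : ℕ
  X = (T * N) * (T * N)
  e₁ : ∀ T N → (T * N) * (T * N) + (T * N) * (T * N) ≡ 2 * (N * N) * (T * T)
  e₁ = solve-∀
  e₂ : ∀ N R d → 2 * (N * N) * (R * R * (2 * d)) ≡ 4 * (R * R) * (N * N) * d
  e₂ = solve-∀

lower-bound : ∀ H r g m → 1 ≤ g → 1 ≤ m → suc m ≡ g + g → ¬ Hom H (K r ⊕ C (suc (suc m))) →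
  ∀ N → N ≡ suc r * m + 2 → ∀ c → c ℚ.< 1ℚ ℚ.- ℕ→ℚ m ℚ.* inv (ℕ→ℚ N) → ¬ Works H (2 + r) c
-- The definition of `Works` is refuted at `η = 1 / κ` with this κ, which does not depend on the
-- scale `T` of the blow-up.
lower-bound H r g m g≥1 m≥1 m≡ ¬hom N N≡ c c< works = refute (4 * (R * R) * (N * N)) refl κ≢0
  where
  R : ℕ
  R = 2 + r
  N≥1 : 1 ≤ N
  N≥1 = ≤-trans (≤-trans (s≤s z≤n) (m≤n+m 2 (suc r * m))) (≤-reflexive (sym N≡))
  instance
    N≢0 : NonZero N
    N≢0 = >-nonZero N≥1
  κ≢0 : NonZero (4 * (R * R) * (N * N))
  κ≢0 = m*n≢0 (4 * (R * R)) (N * N) {{_}} {{m*n≢0 N N}}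

  not-close : ∀ κ → κ ≡ 4 * (R * R) * (N * N) → .{{NonZero κ}} → ∀ T → 1 ≤ T →
    ¬ ApproxPartite (blowUp (LowerBound.F r g g≥1 T m m≡) (LowerBound.w r g g≥1 T m m≡)) R (inv (ℕ→ℚ κ))
  not-close κ κ≡ T T≥1 (a′ , simple′ , sub , col , close) = far-arith T N R lostEdges T≥1 N≥1
    (subst₂ (λ n l → l * lostEdges ≤ n * n) (trans size≡ (cong (T *_) (sym N≡))) κ≡ (η-lower κ lostEdges (size G) close))
    (blowUp-far (suc r) T F-uncolourable (weight≥T m≥1) a′ simple′ sub col)
    where
    open LowerBound r g g≥1 T m m≡
    open BlowUp F F-simple w
    G : Graph
    G = blowUp F w
    lostEdges : ℕ
    lostEdges = edges G ∸ edges (withAdj G a′)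

  refute : ∀ κ → κ ≡ 4 * (R * R) * (N * N) → NonZero κ → ⊥
  refute κ κ≡ κ≢0 = apply (works (inv (ℕ→ℚ κ)) (inv-positive κ {{κ≢0}}))
    where
    apply : (∃ λ n₀ → ∀ (G : Graph) → IsSimple G → n₀ ≤ size G → (H -free) G →
      (∀ v → c ℚ.* ℕ→ℚ (size G) ℚ.≤ ℕ→ℚ (degree G v)) → ApproxPartite G R (inv (ℕ→ℚ κ))) → ⊥
    -- The scale `T = suc n₀` makes the blow-up large enough.
    apply (n₀ , approx) = not-close κ κ≡ {{κ≢0}} (suc n₀) (s≤s z≤n) (approx G blowUp-simple
      (≤-trans (≤-trans (n≤1+n _) (m≤m*n (suc n₀) N)) (≤-reflexive (sym size-G)))
      (blowUp-free H ¬hom)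
      (λ v → subst (λ n → c ℚ.* ℕ→ℚ n ℚ.≤ ℕ→ℚ (degree G v)) (sym size-G)
        (degree-lower c m N (suc n₀) (degree G v) c<
          (subst (λ n → suc n₀ * n ≤ degree G v + suc n₀ * m) (sym N≡) (degree≥ v)))))
      where
      open LowerBound r g g≥1 (suc n₀) m m≡
      open BlowUp F F-simple w
      G : Graph
      G = blowUp F w
      size-G : size G ≡ suc n₀ * N
      size-G = trans size≡ (cong (suc n₀ *_) (sym N≡))

-- The least g

-- Exhaustive search over the finitely many maps, coded as numbers; a map and its decoded code agree
-- pointwise, so the edges are transported.
hom? : ∀ H F → Dec (Hom H F)
hom? H F = map′ (λ (k , e) → Fin.finToFun k , e) encode
  (any? λ k → all? λ u → all? λ v →
    (adj H u v Bool.≟ true) →-dec (adj F (Fin.finToFun k u) (Fin.finToFun k v) Bool.≟ true))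
  where
  encode : Hom H F → ∃ λ k → ∀ u v → adj H u v ≡ true → adj F (Fin.finToFun k u) (Fin.finToFun k v) ≡ true
  encode (f , e) = Fin.funToFin f , λ u v uv →
    subst₂ (λ x y → adj F x y ≡ true) (sym (finToFun-funToFin f u)) (sym (finToFun-funToFin f v)) (e u v uv)

parity : ℕ → Bool
parity zero    = false
parity (suc n) = not (parity n)

parity-double : ∀ g → parity (g + g) ≡ false
parity-double zero    = refl
parity-double (suc g) rewrite +-suc g g | parity-double g = refl

xor-not : ∀ a b → a xor b ≢ not a xor b
xor-not true  true  ()
xor-not true  false ()
xor-not false true  ()
xor-not false false ()

-- An odd cycle minus a vertex p is a path: colour it by parity, flipped beyond p.
pathColour : ∀ {k} → Fin (suc k) → Fin (suc k) → Bool
pathColour p j = parity (toℕ j) xor ⌊ toℕ p <? toℕ j ⌋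

-- Only the step leaving p is monochromatic. Elsewhere the parity changes and the flip does not,
-- except at the wrap-around: it joins two even positions, and only the last one lies beyond p.
pathColour-step : ∀ g (p i j : Fin (suc (g + g))) → i ≢ p → Step i j → pathColour p i ≢ pathColour p j
pathColour-step g p i j i≢p (inj₁ e) with toℕ p <? toℕ i | toℕ p <? toℕ j
... | yes a | yes b rewrite e = xor-not (parity (toℕ i)) true
... | no a  | no b  rewrite e = xor-not (parity (toℕ i)) false
... | yes a | no b  = contradiction (≤-trans a (≤-trans (n≤1+n _) (≤-reflexive (sym e)))) b
... | no a  | yes b = contradiction (toℕ-injective (≤-antisym (≮⇒≥ a) (s≤s⁻¹ (≤-trans b (≤-reflexive e))))) i≢p
pathColour-step g p i j i≢p (inj₂ (e , z)) h
  rewrite e | z | parity-double g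
  with toℕ p <? g + g | toℕ p <? 0
... | yes _ | no _ = contradiction h λ ()
... | no a  | _    = contradiction (toℕ-injective (trans e (≤-antisym (≮⇒≥ a) (s≤s⁻¹ (toℕ<n p))))) i≢p

missed-vertex : ∀ H r k (f : Fin (size H) → Fin (r + suc k)) → size H < suc k →
  ∃ λ p → ∀ u → f u ≢ r ↑ʳ p
missed-vertex H r k f small with all? (λ p → any? λ u → f u Fin.≟ r ↑ʳ p)
... | no ¬all = let p , ¬u = ¬∀⟶∃¬ (suc k) _ (λ p → any? λ u → f u Fin.≟ r ↑ʳ p) ¬all in p , λ u e → ¬u (u , e)
... | yes all-hit =
  let p , p′ , p<p′ , e = pigeonhole small (λ p → proj₁ (all-hit p)) in
  contradiction (↑ʳ-injective r p p′ (trans (sym (proj₂ (all-hit p))) (trans (cong f e) (proj₂ (all-hit p′)))))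
                (λ h → <⇒≢ p<p′ (cong toℕ h))

long-cycle-colouring : ∀ H r g → size H < suc (g + g) → Hom H (K r ⊕ C (suc (g + g))) → Hom H (K (2 + r))
long-cycle-colouring H r g small (f , edge) = colour ∘ splitAt r ∘ f , λ u v uv → K-adj⁺
  (proper (splitAt r (f u)) (splitAt r (f v)) (avoids u) (avoids v)
    (trans (sym (⊕-adj (K r) (C (suc (g + g))) (f u) (f v))) (edge u v uv)))
  where
  k : ℕ
  k = g + g
  p : Fin (suc k)
  p = proj₁ (missed-vertex H r k f small)
  avoids : ∀ u → splitAt r (f u) ≢ inj₂ p
  avoids u e = proj₂ (missed-vertex H r k f small) u
    (trans (sym (join-splitAt r (suc k) (f u))) (cong (join r (suc k)) e))
  bit : Bool → Fin (2 + r)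
  bit false = zero
  bit true  = suc zero
  bit-inj : ∀ a b → bit a ≡ bit b → a ≡ b
  bit-inj true  true  _ = refl
  bit-inj false false _ = refl
  bit≢ : ∀ b {i : Fin r} → bit b ≢ suc (suc i)
  bit≢ true  ()
  bit≢ false ()
  colour : Fin r ⊎ Fin (suc k) → Fin (2 + r)
  colour (inj₁ i) = suc (suc i)
  colour (inj₂ j) = bit (pathColour p j)
  proper : ∀ s t → s ≢ inj₂ p → t ≢ inj₂ p → joinAdj (K r) (C (suc k)) s t ≡ true → colour s ≢ colour t
  proper (inj₁ i) (inj₁ j) _ _ h refl = K-adj⁻ h refl
  proper (inj₁ i) (inj₂ j) _ _ h e = bit≢ (pathColour p j) (sym e)
  proper (inj₂ i) (inj₁ j) _ _ h e = bit≢ (pathColour p i) e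
  proper (inj₂ i) (inj₂ j) i≢ j≢ h e with C-adj⁻ i j h | bit-inj _ _ e
  ... | inj₁ s | e′ = pathColour-step g p i j (i≢ ∘ cong inj₂) s e′
  ... | inj₂ s | e′ = pathColour-step g p j i (j≢ ∘ cong inj₂) s (sym e′)

-- Linear search from 1; the fuel is the distance to the known failure at `suc n`.
least-failure : ∀ (Q : ℕ → Set) → (∀ g → Dec (Q g)) → ∀ n → ¬ Q (suc n) →
  ∃ λ g → 1 ≤ g × ¬ Q g × (∀ g′ → 1 ≤ g′ → g′ < g → Q g′)
least-failure Q Q? n ¬Q = go n 1 ¬Q (s≤s z≤n) (λ g′ p q → contradiction p (<⇒≱ q))
  where
  go : ∀ fuel s → ¬ Q (s + fuel) → 1 ≤ s → (∀ g′ → 1 ≤ g′ → g′ < s → Q g′) →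
    ∃ λ g → 1 ≤ g × ¬ Q g × (∀ g′ → 1 ≤ g′ → g′ < g → Q g′)
  go fuel s ¬Q s≥1 below with Q? s
  go fuel       s ¬Q s≥1 below | no ¬Qs = s , s≥1 , ¬Qs , below
  go zero       s ¬Q s≥1 below | yes Qs = contradiction (subst Q (sym (+-identityʳ s)) Qs) ¬Q
  go (suc fuel) s ¬Q s≥1 below | yes Qs = go fuel (suc s) (subst (¬_ ∘ Q) (+-suc s fuel) ¬Q) (s≤s z≤n) below′
    where
    below′ : ∀ g′ → 1 ≤ g′ → g′ < suc s → Q g′
    below′ g′ p q with g′ <? s
    ... | yes lt = below g′ p lt
    ... | no ¬lt = subst Q (≤-antisym (≮⇒≥ ¬lt) (s≤s⁻¹ q)) Qs

odd-length : ∀ g → 2 * g + 1 ≡ suc (g + g)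
odd-length g = trans (+-comm (2 * g) 1) (cong (λ x → suc (g + x)) (+-identityʳ g))

least-g : ∀ H r → ¬ Hom H (K (2 + r)) →
  ∃ λ g → 1 ≤ g × ¬ Hom H (K r ⊕ C (2 * g + 1)) × (∀ g′ → 1 ≤ g′ → g′ < g → Hom H (K r ⊕ C (2 * g′ + 1)))
least-g H r ¬col = least-failure (λ g → Hom H (K r ⊕ C (2 * g + 1))) (λ g → hom? H (K r ⊕ C (2 * g + 1))) (size H)
  -- At `g = suc (size H)` the cycle has more vertices than `H`.
  λ hom → ¬col (long-cycle-colouring H r (suc (size H)) (s≤s (≤-trans (n≤1+n _) (m≤m+n _ _)))
    (subst (λ m → Hom H (K r ⊕ C m)) (odd-length (suc (size H))) hom))

theorem3p1 : (H : Graph) → IsSimple H → (r : ℕ) → 2 ≤ r →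
    ChromaticNumber H (suc r) →
    Σ ℕ λ g → (1 ≤ g × ¬ Hom H (K (r ∸ 2) ⊕ C (2 * g + 1))
    × (∀ g′ → 1 ≤ g′ → g′ < g → Hom H (K (r ∸ 2) ⊕ C (2 * g′ + 1))))
    × ((1ℚ ℚ.- inv (ℕ→ℚ r ℚ.- 1ℚ))
    ℚ.< (1ℚ ℚ.- inv ((ℕ→ℚ r ℚ.- 1ℚ) ℚ.+ ℕ→ℚ 2 ℚ.* inv (ℕ→ℚ (2 * g ∸ 1))))
    × δ≥ H r (1ℚ ℚ.- inv ((ℕ→ℚ r ℚ.- 1ℚ) ℚ.+ ℕ→ℚ 2 ℚ.* inv (ℕ→ℚ (2 * g ∸ 1))))
    × δ≤ H r (1ℚ ℚ.- inv (ℕ→ℚ r ℚ.- inv (ℕ→ℚ 3))))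
theorem3p1 H _ (suc zero) (s≤s ())
theorem3p1 H _ (suc (suc r)) _ (col , ¬col) =
  let g , g≥1 , ¬hom , below = least-g H r ¬col
      m≥1 , m≡ , length≡ = cycle-arith g g≥1
      strict , lower = bounds g g≥1 (2 * g ∸ 1) m≥1 m≡ (subst (λ l → ¬ Hom H (K r ⊕ C l)) length≡ ¬hom)
  in g , (g≥1 , ¬hom , below) , strict , lower , upper-bound H r col
  where
  cycle-arith : ∀ g → 1 ≤ g → 1 ≤ 2 * g ∸ 1 × suc (2 * g ∸ 1) ≡ g + g × 2 * g + 1 ≡ suc (suc (2 * g ∸ 1))
  cycle-arith (suc g) _ = ≤-trans (s≤s z≤n) (m≤n+m (suc (g + 0)) g) , cong (suc g +_) (+-identityʳ (suc g)) , +-comm (2 * suc g) 1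
  bounds : ∀ g → 1 ≤ g → ∀ m → 1 ≤ m → suc m ≡ g + g → ¬ Hom H (K r ⊕ C (suc (suc m))) →
    let L = 1ℚ ℚ.- inv ((ℕ→ℚ (2 + r) ℚ.- 1ℚ) ℚ.+ ℕ→ℚ 2 ℚ.* inv (ℕ→ℚ m)) in
    (1ℚ ℚ.- inv (ℕ→ℚ (2 + r) ℚ.- 1ℚ)) ℚ.< L × δ≥ H (2 + r) L
  bounds g g≥1 m m≥1 m≡ ¬hom =
    subst₂ ℚ._<_ (cong (λ x → 1ℚ ℚ.- inv x) (sym (ℕ→ℚ-suc∸1 (suc r)))) (sym L≡) (lower-bound-strict (suc r) m N refl) ,
    λ c c<L → lower-bound H r g m g≥1 m≥1 m≡ ¬hom N refl c (subst (c ℚ.<_) L≡ c<L)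
    where
    N : ℕ
    -- The total weight: m on each of r clique vertices and 1 on each of the 2g + 1 = m + 2 cycle
    -- vertices.
    N = suc r * m + 2
    instance
      m≢0 : NonZero m
      m≢0 = >-nonZero m≥1
      N≢0 : NonZero N
      N≢0 = >-nonZero (≤-trans (s≤s z≤n) (m≤n+m 2 (suc r * m)))
    L≡ : 1ℚ ℚ.- inv ((ℕ→ℚ (2 + r) ℚ.- 1ℚ) ℚ.+ ℕ→ℚ 2 ℚ.* inv (ℕ→ℚ m)) ≡ 1ℚ ℚ.- ℕ→ℚ m ℚ.* inv (ℕ→ℚ N)
    L≡ = cong (λ x → 1ℚ ℚ.- x) (trans (cong (λ x → inv (x ℚ.+ ℕ→ℚ 2 ℚ.* inv (ℕ→ℚ m))) (ℕ→ℚ-suc∸1 (suc r))) (inv-lower (suc r) m N refl))
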